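{- For any $k$ and any regular $k$-gon $P$ there exists an $n$-vertex graph $G\in P_{hom}$ with $\Omega\bigl(n^{\lfloor k/2\rfloor(1-\epsilon)}\bigr)$ maximal cliques, for any constant $\epsilon>0$. Moreover, if $k$ is a constant, then a bound $\Omega\bigl(n^{\lfloor k/2\rfloor}\bigr)$ holds.
   Context: A polygon means a closed convex polygon in the plane. For a collection of sets, its intersection graph has one vertex for each member of the collection, and two distinct vertices are adjacent if and only if the corresponding sets have nonempty intersection. Two sets are homothetic if one of them can be obtained from the other by scaling and/or translating. $P_{hom}$ is the class of intersection graphs of collections of sets homothetic to $P$. Maximal cliques are maximal with respect to inclusion. -}

module Defs where

open import Algebra.Bundles using (CommutativeRing)
import Algebra.Properties.Monoid.Mult as MonoidMult
import Algebra.Properties.Ring as RingProperties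
import Algebra.Properties.Semiring.Exp as SemiringExp
import Algebra.Properties.CommutativeMonoid.Sum as MonoidSum
open import Data.Fin.Base using (Fin; toℕ)
open import Data.Fin.Properties using (all?) renaming (_≟_ to _≟ᶠ_)
open import Data.Fin.Subset as Subset using (Subset; inside; outside)
open import Data.Fin.Subset.Properties using (anySubset?; _⊆?_) renaming (_∈?_ to _∈ˢ?_)
open import Data.List.Base using (List; []; _∷_; _++_; map; filter; length)
import Data.Bool.Properties as Bool
open import Data.Nat.Base as ℕ using (ℕ; zero; suc; NonZero)
open import Data.Nat.DivMod using (_mod_)
open import Data.Product.Base using (∃; _×_; _,_; proj₁; proj₂; Σ-syntax; ∃-syntax)
open import Data.Sum.Base using (inj₁; inj₂)
import Data.Vec.Base as Vec
import Data.Vec.Properties as Vec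
open import Function.Base using (_∘_)
open import Function.Bundles using (_⇔_)
open import Level using (0ℓ)
open import Relation.Binary.Core using (Rel)
open import Relation.Binary.Bundles using (DecTotalOrder)
open import Relation.Binary.Definitions using (Decidable; Symmetric; Irreflexive)
open import Relation.Binary.PropositionalEquality.Core using (_≡_; _≢_)
open import Relation.Binary.Structures using (IsDecTotalOrder)
import Relation.Binary.Construct.NonStrictToStrict as Strict
import Relation.Binary.Reasoning.PartialOrder as OrderReasoning
open import Relation.Nullary.Decidable using (Dec; yes; no; map′; _×-dec_; _→-dec_; ¬?; decidable-stable)
open import Relation.Nullary.Negation using (¬_; contradiction)
import Relation.Unary as U
open import Relation.Unary using (Pred; _∈_; _≐_; _≬_)

------------------------------------------------------------------------
-- Finite graphs and their maximal cliques

record Graph (n : ℕ) : Set₁ where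
  infix 4 _~_ _~?_
  field
    _~_    : Rel (Fin n) 0ℓ
    _~?_   : Decidable _~_
    sym    : Symmetric _~_
    irrefl : Irreflexive _≡_ _~_

subsets : ∀ n → List (Subset n)
subsets zero    = Vec.[] ∷ []
subsets (suc n) = map (inside Vec.∷_) (subsets n) ++ map (outside Vec.∷_) (subsets n)

module _ {n : ℕ} (G : Graph n) where
  open Graph G

  IsClique : Pred (Subset n) 0ℓ
  IsClique S = ∀ i j → i Subset.∈ S → j Subset.∈ S → i ≢ j → i ~ j

  IsMaximalClique : Pred (Subset n) 0ℓ
  IsMaximalClique S = IsClique S × (∀ T → IsClique T → S Subset.⊆ T → S ≡ T)

  isClique? : U.Decidable IsClique
  isClique? S = all? λ i → all? λ j →
    (i ∈ˢ? S) →-dec (j ∈ˢ? S) →-dec ¬? (i ≟ᶠ j) →-dec (i ~? j)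

  isMaximalClique? : U.Decidable IsMaximalClique
  isMaximalClique? S = isClique? S ×-dec
    map′ (λ ¬∃ T → decidable-stable (ok? T) (¬∃ ∘ (T ,_)))
         (λ ∀T (T , ¬ok) → ¬ok (∀T T))
         (¬? (anySubset? (¬? ∘ ok?)))
    where
    ok? : ∀ T → Dec (IsClique T → S Subset.⊆ T → S ≡ T)
    ok? T = isClique? T →-dec (S ⊆? T) →-dec Vec.≡-dec Bool._≟_ S T

  #maximalCliques : ℕ
  #maximalCliques = length (filter isMaximalClique? (subsets n))

IsIntersectionGraph : ∀ {A : Set} {n} → Graph n → (Fin n → Pred A 0ℓ) → Set
IsIntersectionGraph G F = ∀ i j → (i ~ j) ⇔ (i ≢ j × F i ≬ F j)
  where open Graph G

------------------------------------------------------------------------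
-- The real numbers, characterised as a complete ordered field

-- The supremum s of S is specified as an upper bound such that every y < s is
-- exceeded by some element of S.  Classically this says exactly that s is the
-- least upper bound.

record CompleteOrderedField : Set₁ where
  field
    commutativeRing : CommutativeRing 0ℓ 0ℓ
  open CommutativeRing commutativeRing public
  infix 4 _≤_
  field
    _≤_             : Rel Carrier 0ℓ
    isDecTotalOrder : IsDecTotalOrder _≈_ _≤_
  open Strict _≈_ _≤_ public using (_<_)
  field
    0≉1       : ¬ (0# ≈ 1#)
    inverse   : ∀ x → ¬ (x ≈ 0#) → ∃[ y ] x * y ≈ 1#
    +-monoʳ-≤ : ∀ x {y z} → y ≤ z → x + y ≤ x + z
    *-nonNeg  : ∀ {x y} → 0# ≤ x → 0# ≤ y → 0# ≤ x * y
    supremum  : (S : Pred Carrier 0ℓ) →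
                ∃ S →
                (∃[ b ] ∀ x → x ∈ S → x ≤ b) →
                ∃[ s ] (∀ x → x ∈ S → x ≤ s) ×
                       (∀ y → y < s → ∃[ x ] x ∈ S × y < x)

  decTotalOrder : DecTotalOrder 0ℓ 0ℓ 0ℓ
  decTotalOrder = record { isDecTotalOrder = isDecTotalOrder }

  open SemiringExp semiring public using (_^_)
  open MonoidMult +-monoid using () renaming (_×_ to _·_)

  fromℕ : ℕ → Carrier
  fromℕ n = n · 1#

------------------------------------------------------------------------
-- Powers of positive integers with real exponents

module RealPower (ℝ : CompleteOrderedField) where
  open CompleteOrderedField ℝ

  private
    open DecTotalOrder decTotalOrder using (poset; total; _≤?_; antisym)
      renaming (refl to ≤-refl; reflexive to ≤-reflexive; trans to ≤-trans;
                ≤-respˡ-≈ to ≤-respˡ-≈; ≤-respʳ-≈ to ≤-respʳ-≈)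
    open RingProperties ring using (-‿distribʳ-*; -1*x≈-x; -‿involutive)
    open SemiringExp semiring using (^-homo-*; ^-assocʳ; ^-congˡ; ^-congʳ)
    open MonoidMult +-monoid using (×-homo-+)
    open OrderReasoning poset

    <⇒≱ : ∀ {x y} → x < y → ¬ (y ≤ x)
    <⇒≱ (x≤y , x≉y) y≤x = x≉y (antisym x≤y y≤x)

    -x+[x+y]≈y : ∀ x y → - x + (x + y) ≈ y
    -x+[x+y]≈y x y = trans (sym (+-assoc _ _ _))
      (trans (+-congʳ (-‿inverseˡ x)) (+-identityˡ y))

    x+[-x+y]≈y : ∀ x y → x + (- x + y) ≈ y
    x+[-x+y]≈y x y = trans (sym (+-assoc _ _ _))
      (trans (+-congʳ (-‿inverseʳ x)) (+-identityˡ y))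

    +-cancelˡ-≤ : ∀ x {y z} → x + y ≤ x + z → y ≤ z
    +-cancelˡ-≤ x {y} {z} le = begin
      y             ≈⟨ -x+[x+y]≈y x y ⟨
      - x + (x + y) ≤⟨ +-monoʳ-≤ (- x) le ⟩
      - x + (x + z) ≈⟨ -x+[x+y]≈y x z ⟩
      z             ∎

    +-monoˡ-≤ : ∀ x {y z} → y ≤ z → y + x ≤ z + x
    +-monoˡ-≤ x {y} {z} le = begin
      y + x ≈⟨ +-comm y x ⟩
      x + y ≤⟨ +-monoʳ-≤ x le ⟩
      x + z ≈⟨ +-comm x z ⟩
      z + x ∎

    *-monoʳ-≤ : ∀ {x y z} → 0# ≤ x → y ≤ z → x * y ≤ x * z
    *-monoʳ-≤ {x} {y} {z} 0≤x y≤z = begin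
      x * y                      ≈⟨ +-identityʳ _ ⟨
      x * y + 0#                 ≤⟨ +-monoʳ-≤ _ (*-nonNeg 0≤x 0≤z-y) ⟩
      x * y + x * (- y + z)      ≈⟨ distribˡ x y _ ⟨
      x * (y + (- y + z))        ≈⟨ *-congˡ (x+[-x+y]≈y y z) ⟩
      x * z                      ∎
      where
      0≤z-y : 0# ≤ - y + z
      0≤z-y = begin
        0#      ≈⟨ -‿inverseˡ y ⟨
        - y + y ≤⟨ +-monoʳ-≤ (- y) y≤z ⟩
        - y + z ∎

    *-monoˡ-≤ : ∀ {x y z} → 0# ≤ x → y ≤ z → y * x ≤ z * x
    *-monoˡ-≤ {x} {y} {z} 0≤x y≤z = begin
      y * x ≈⟨ *-comm y x ⟩
      x * y ≤⟨ *-monoʳ-≤ 0≤x y≤z ⟩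
      x * z ≈⟨ *-comm x z ⟩
      z * x ∎

    *-cancelˡ : ∀ {x y z} → ¬ (x ≈ 0#) → x * y ≈ x * z → y ≈ z
    *-cancelˡ {x} {y} {z} x≉0 eq with inverse x x≉0
    ... | w , xw≈1 = trans (sym (lemma y)) (trans (*-congˡ eq) (lemma z))
      where
      lemma : ∀ u → w * (x * u) ≈ u
      lemma u = trans (sym (*-assoc w x u))
        (trans (*-congʳ (trans (*-comm w x) xw≈1)) (*-identityˡ u))

    0≤1 : 0# ≤ 1#
    0≤1 with total 0# 1#
    ... | inj₁ le = le
    ... | inj₂ ge = ≤-respʳ-≈ (trans (-1*x≈-x (- 1#)) (-‿involutive 1#))
                              (*-nonNeg 0≤-1 0≤-1)
      where
      0≤-1 : 0# ≤ - 1#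
      0≤-1 = begin
        0#        ≈⟨ -‿inverseˡ 1# ⟨
        - 1# + 1# ≤⟨ +-monoʳ-≤ (- 1#) ge ⟩
        - 1# + 0# ≈⟨ +-identityʳ _ ⟩
        - 1#      ∎

    0<1 : 0# < 1#
    0<1 = 0≤1 , 0≉1

    0<⇒≉0 : ∀ {x} → 0# < x → ¬ (x ≈ 0#)
    0<⇒≉0 (_ , ne) eq = ne (sym eq)

    *-monoʳ-< : ∀ {x y z} → 0# < x → y < z → x * y < x * z
    *-monoʳ-< 0<x (y≤z , y≉z) =
      *-monoʳ-≤ (proj₁ 0<x) y≤z , y≉z ∘ *-cancelˡ (0<⇒≉0 0<x)

    *-pos : ∀ {x y} → 0# < x → 0# < y → 0# < x * y
    *-pos {x} {y} 0<x 0<y with *-monoʳ-< 0<x 0<y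
    ... | le , ne = ≤-respˡ-≈ (zeroʳ x) le , ne ∘ trans (zeroʳ x)

    ^-pos : ∀ {x} → 0# < x → ∀ m → 0# < x ^ m
    ^-pos 0<x zero    = 0<1
    ^-pos 0<x (suc m) = *-pos 0<x (^-pos 0<x m)

    ^-mono-≤ : ∀ {x y} → 0# < x → x ≤ y → ∀ m → x ^ m ≤ y ^ m
    ^-mono-≤ 0<x x≤y zero    = ≤-refl
    ^-mono-≤ {x} {y} 0<x x≤y (suc m) = begin
      x * x ^ m ≤⟨ *-monoʳ-≤ (proj₁ 0<x) (^-mono-≤ 0<x x≤y m) ⟩
      x * y ^ m ≤⟨ *-monoˡ-≤ (≤-trans (proj₁ (^-pos 0<x m)) (^-mono-≤ 0<x x≤y m)) x≤y ⟩
      y * y ^ m ∎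

    ^-cancel-≤ : ∀ {x y z} q → 0# < y → 0# < z →
                 z * x ^ suc q ≤ z * y ^ suc q → x ≤ y
    ^-cancel-≤ {x} {y} {z} q 0<y 0<z le with x ≤? y
    ... | yes x≤y = x≤y
    ... | no  x≰y = contradiction le (<⇒≱ (*-monoʳ-< 0<z y^<x^))
      where
      y<x : y < x
      y<x with total x y
      ... | inj₁ x≤y = contradiction x≤y x≰y
      ... | inj₂ y≤x = y≤x , x≰y ∘ ≤-reflexive ∘ sym
      0<x : 0# < x
      0<x = ≤-trans (proj₁ 0<y) (proj₁ y<x) ,
            λ 0≈x → <⇒≱ y<x (≤-respˡ-≈ 0≈x (proj₁ 0<y))
      lt : y * x ^ q < x * x ^ q
      lt with *-monoʳ-< (^-pos 0<x q) y<x
      ... | le′ , ne = ≤-respˡ-≈ (*-comm _ _) (≤-respʳ-≈ (*-comm _ _) le′) ,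
                       λ eq → ne (trans (*-comm _ _) (trans eq (*-comm _ _)))
      le″ : y * y ^ q ≤ y * x ^ q
      le″ = *-monoʳ-≤ (proj₁ 0<y) (^-mono-≤ 0<y (proj₁ y<x) q)
      y^<x^ : y ^ suc q < x ^ suc q
      y^<x^ = ≤-trans le″ (proj₁ lt) ,
              λ eq → <⇒≱ lt (≤-respˡ-≈ eq le″)

    0≤fromℕ : ∀ m → 0# ≤ fromℕ m
    0≤fromℕ zero    = ≤-refl
    0≤fromℕ (suc m) = begin
      0#           ≤⟨ 0≤fromℕ m ⟩
      fromℕ m      ≈⟨ +-identityˡ _ ⟨
      0# + fromℕ m ≤⟨ +-monoˡ-≤ _ 0≤1 ⟩
      1# + fromℕ m ∎

    1≤fromℕ : ∀ m .{{_ : NonZero m}} → 1# ≤ fromℕ m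
    1≤fromℕ (suc m) = begin
      1#           ≈⟨ +-identityʳ _ ⟨
      1# + 0#      ≤⟨ +-monoʳ-≤ 1# (0≤fromℕ m) ⟩
      1# + fromℕ m ∎

    0<fromℕ : ∀ m .{{_ : NonZero m}} → 0# < fromℕ m
    0<fromℕ m = 0≤fromℕ m ,
      λ eq → <⇒≱ 0<1 (≤-respʳ-≈ (sym eq) (1≤fromℕ m))

    fromℕ-cancel-≤ : ∀ a b → fromℕ a ≤ fromℕ b → a ℕ.≤ b
    fromℕ-cancel-≤ zero    b       _  = ℕ.z≤n
    fromℕ-cancel-≤ (suc a) zero    le = contradiction le (<⇒≱ (0<fromℕ (suc a)))
    fromℕ-cancel-≤ (suc a) (suc b) le =
      ℕ.s≤s (fromℕ-cancel-≤ a b (+-cancelˡ-≤ 1# le))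

    fromℕ-homo-* : ∀ a b → fromℕ (a ℕ.* b) ≈ fromℕ a * fromℕ b
    fromℕ-homo-* zero    b = sym (zeroˡ _)
    fromℕ-homo-* (suc a) b = begin-equality
      fromℕ (b ℕ.+ a ℕ.* b)                 ≈⟨ ×-homo-+ 1# b (a ℕ.* b) ⟩
      fromℕ b + fromℕ (a ℕ.* b)             ≈⟨ +-cong (sym (*-identityˡ _)) (fromℕ-homo-* a b) ⟩
      1# * fromℕ b + fromℕ a * fromℕ b      ≈⟨ distribʳ _ _ _ ⟨
      (1# + fromℕ a) * fromℕ b              ∎

    1≤^ : ∀ {x} → 1# ≤ x → ∀ m → 1# ≤ x ^ m
    1≤^ 1≤x zero    = ≤-refl
    1≤^ {x} 1≤x (suc m) = begin
      1#        ≤⟨ 1≤x ⟩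
      x         ≈⟨ *-identityʳ x ⟨
      x * 1#    ≤⟨ *-monoʳ-≤ (≤-trans 0≤1 1≤x) (1≤^ 1≤x m) ⟩
      x * x ^ m ∎

    ^-monoʳ-≤ : ∀ {x} → 1# ≤ x → ∀ {a b} → a ℕ.≤ b → x ^ a ≤ x ^ b
    ^-monoʳ-≤ 1≤x {b = b} ℕ.z≤n = 1≤^ 1≤x b
    ^-monoʳ-≤ 1≤x (ℕ.s≤s a≤b)  = *-monoʳ-≤ (≤-trans 0≤1 1≤x) (^-monoʳ-≤ 1≤x a≤b)

    archimedean : ∀ x → ∃[ m ] x ≤ fromℕ m
    archimedean x with total x 0#
    ... | inj₁ x≤0 = 0 , x≤0
    ... | inj₂ 0≤x = helper
      where
      S : Pred Carrier 0ℓ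
      S y = ∃[ m ] y ≈ fromℕ m × fromℕ m ≤ x

      helper : ∃[ m ] x ≤ fromℕ m
      helper with supremum S (0# , 0 , refl , 0≤x)
                    (x , λ { y (m , y≈m , m≤x) → ≤-respˡ-≈ (sym y≈m) m≤x })
      ... | s , ub , least with least (- 1# + s) (s-1≤s , s-1≉s)
        where
        s-1≤s : - 1# + s ≤ s
        s-1≤s = +-cancelˡ-≤ 1# (begin
          1# + (- 1# + s) ≈⟨ x+[-x+y]≈y 1# s ⟩
          s               ≈⟨ +-identityˡ s ⟨
          0# + s          ≤⟨ +-monoˡ-≤ s 0≤1 ⟩
          1# + s          ∎)
        s-1≉s : ¬ (- 1# + s ≈ s)
        s-1≉s eq = 0≉1 (begin-equality
          0#              ≈⟨ -‿inverseʳ s ⟨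
          s + - s         ≈⟨ +-congʳ (x+[-x+y]≈y 1# s) ⟨
          1# + (- 1# + s) + - s ≈⟨ +-congʳ (+-congˡ eq) ⟩
          1# + s + - s    ≈⟨ +-assoc _ _ _ ⟩
          1# + (s + - s)  ≈⟨ +-congˡ (-‿inverseʳ s) ⟩
          1# + 0#         ≈⟨ +-identityʳ 1# ⟩
          1#              ∎)
      ... | z , (m , z≈m , m≤x) , s-1<z with total x (fromℕ (suc m))
      ... | inj₁ x≤  = suc m , x≤
      ... | inj₂ m+1≤x = contradiction z≤s-1 (<⇒≱ s-1<z)
        where
        z≤s-1 : z ≤ - 1# + s
        z≤s-1 = begin
          z                     ≈⟨ z≈m ⟩
          fromℕ m               ≈⟨ -x+[x+y]≈y 1# (fromℕ m) ⟨
          - 1# + fromℕ (suc m)  ≤⟨ +-monoʳ-≤ (- 1#) (ub _ (suc m , refl , m+1≤x)) ⟩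
          - 1# + s              ∎

  -- x is the power n ^ ((a - b) / (1 + q)), where (a - b) / (1 + q) ≤ r.
  IsRationalPowerUpTo : (n : ℕ) (r : Carrier) → Pred Carrier 0ℓ
  IsRationalPowerUpTo n r x = 0# ≤ x × ∃[ a ] ∃[ b ] ∃[ q ]
    (x ^ suc q * fromℕ n ^ b ≈ fromℕ n ^ a) ×
    (fromℕ a ≤ fromℕ (suc q) * r + fromℕ b)

  private
    nonempty : ∀ n .{{_ : NonZero n}} r → ∃ (IsRationalPowerUpTo n r)
    nonempty n r with archimedean (- r)
    ... | b , -r≤b with inverse (fromℕ n ^ b) (0<⇒≉0 (^-pos (0<fromℕ n) b))
    ... | x , nᵇx≈1 = x , 0≤x , 0 , b , 0 ,
          trans (*-congʳ (*-identityʳ x)) (trans (*-comm _ _) nᵇx≈1) , (begin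
            0#                    ≈⟨ -‿inverseʳ r ⟨
            r + - r               ≤⟨ +-monoʳ-≤ r -r≤b ⟩
            r + fromℕ b           ≈⟨ +-congʳ (*-identityˡ r) ⟨
            1# * r + fromℕ b      ≈⟨ +-congʳ (*-congʳ (+-identityʳ 1#)) ⟨
            fromℕ 1 * r + fromℕ b ∎)
      where
      0≤x : 0# ≤ x
      0≤x with total 0# x
      ... | inj₁ le = le
      ... | inj₂ ge = contradiction
        (≤-respˡ-≈ nᵇx≈1 (≤-respʳ-≈ (zeroʳ _) (*-monoʳ-≤ (proj₁ (^-pos (0<fromℕ n) b)) ge)))
        (<⇒≱ 0<1)

    bounded : ∀ n .{{_ : NonZero n}} r →
              ∃[ y ] ∀ x → x ∈ IsRationalPowerUpTo n r → x ≤ y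
    bounded n r with archimedean r
    ... | m , r≤m = N ^ m , bound
      where
      N = fromℕ n
      bound : ∀ x → x ∈ IsRationalPowerUpTo n r → x ≤ N ^ m
      bound x (_ , a , b , q , eq , a≤) =
        ^-cancel-≤ q (^-pos (0<fromℕ n) m) (^-pos (0<fromℕ n) b) (begin
          N ^ b * x ^ suc q         ≈⟨ *-comm _ _ ⟩
          x ^ suc q * N ^ b         ≈⟨ eq ⟩
          N ^ a                     ≤⟨ ^-monoʳ-≤ (1≤fromℕ n) a≤ℕ ⟩
          N ^ (m ℕ.* suc q ℕ.+ b)   ≈⟨ ^-homo-* N (m ℕ.* suc q) b ⟩
          N ^ (m ℕ.* suc q) * N ^ b ≈⟨ *-comm _ _ ⟩
          N ^ b * N ^ (m ℕ.* suc q) ≈⟨ *-congˡ (^-assocʳ N m (suc q)) ⟨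
          N ^ b * (N ^ m) ^ suc q   ∎)
        where
        a≤ℕ : a ℕ.≤ m ℕ.* suc q ℕ.+ b
        a≤ℕ = fromℕ-cancel-≤ a _ (begin
          fromℕ a                           ≤⟨ a≤ ⟩
          fromℕ (suc q) * r + fromℕ b       ≤⟨ +-monoˡ-≤ _ (*-monoʳ-≤ (0≤fromℕ (suc q)) r≤m) ⟩
          fromℕ (suc q) * fromℕ m + fromℕ b ≈⟨ +-congʳ (*-comm _ _) ⟩
          fromℕ m * fromℕ (suc q) + fromℕ b ≈⟨ +-congʳ (fromℕ-homo-* m (suc q)) ⟨
          fromℕ (m ℕ.* suc q) + fromℕ b     ≈⟨ ×-homo-+ 1# (m ℕ.* suc q) b ⟨
          fromℕ (m ℕ.* suc q ℕ.+ b)         ∎)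

  infixr 8 _^ʳ_

  _^ʳ_ : (n : ℕ) .{{_ : NonZero n}} → Carrier → Carrier
  n ^ʳ r = proj₁ (supremum (IsRationalPowerUpTo n r) (nonempty n r) (bounded n r))

------------------------------------------------------------------------
-- Regular polygons and homothets in the plane

-- Successor modulo k.
next : ∀ {k} → Fin k → Fin k
next {suc k} i = suc (toℕ i) mod suc k

module Plane (ℝ : CompleteOrderedField) where
  open CompleteOrderedField ℝ
  open MonoidSum +-commutativeMonoid using (sum)

  Point : Set
  Point = Carrier × Carrier

  infix  4 _≈ₚ_
  infixl 6 _+ₚ_ _-ₚ_
  infixl 7 _*ₚ_

  _≈ₚ_ : Rel Point 0ℓ
  (x , y) ≈ₚ (x′ , y′) = x ≈ x′ × y ≈ y′

  _+ₚ_ _-ₚ_ : Point → Point → Point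
  (x , y) +ₚ (x′ , y′) = x + x′ , y + y′
  (x , y) -ₚ (x′ , y′) = x - x′ , y - y′

  _*ₚ_ : Carrier → Point → Point
  t *ₚ (x , y) = t * x , t * y

  dot cross : Point → Point → Carrier
  dot   (x , y) (x′ , y′) = x * x′ + y * y′
  cross (x , y) (x′ , y′) = x * y′ - y * x′

  convexHull : ∀ {k} → (Fin k → Point) → Pred Point 0ℓ
  convexHull {k} v p = Σ[ w ∈ (Fin k → Carrier) ]
    (∀ i → 0# ≤ w i) ×
    (sum w ≈ 1#) ×
    (p ≈ₚ (sum (λ i → w i * proj₁ (v i)) , sum (λ i → w i * proj₂ (v i))))

  module _ {k} (v : Fin k → Point) where
    edge : Fin k → Point
    edge i = v (next i) -ₚ v i

    -- The vertices are in strictly convex position, listed counterclockwise: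
    -- all other vertices lie strictly to the left of each directed edge.
    IsConvexPosition : Set
    IsConvexPosition = ∀ i j → j ≢ i → j ≢ next i → 0# < cross (edge i) (v j -ₚ v i)

    IsEquilateral : Set
    IsEquilateral = ∀ i j → dot (edge i) (edge i) ≈ dot (edge j) (edge j)

    -- For an equilateral convex polygon the dot product of consecutive edges
    -- determines the cosine of the angle between them, hence the angle.
    IsEquiangular : Set
    IsEquiangular = ∀ i j → dot (edge i) (edge (next i)) ≈ dot (edge j) (edge (next j))

  IsRegularPolygon : ℕ → Pred Point 0ℓ → Set
  IsRegularPolygon k P = 3 ℕ.≤ k × Σ[ v ∈ (Fin k → Point) ]
    IsConvexPosition v × IsEquilateral v × IsEquiangular v × P ≐ convexHull v

  Homothetic : Rel (Pred Point 0ℓ) 0ℓ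
  Homothetic Q P = ∃[ t ] ∃[ u ] 0# < t ×
    Q ≐ (λ q → ∃[ p ] p ∈ P × q ≈ₚ t *ₚ p +ₚ u)

  infix 4 _∈Hom_

  _∈Hom_ : ∀ {n} → Graph n → Pred Point 0ℓ → Set₁
  _∈Hom_ {n} G P = Σ[ F ∈ (Fin n → Pred Point 0ℓ) ]
    (∀ i → Homothetic (F i) P) × IsIntersectionGraph G F

-- Let m = ⌊k/2⌋.  For each of m consecutive edge directions j take a "near" family of translates
-- of 2P meeting the origin in the midpoint of edge j, and a "far" family meeting it in the point
-- of P opposite to that edge, and push both families apart by small amounts growing with a rank.
-- Then near a and far b are disjoint exactly when b < a, and all other pairs intersect.  The
-- maximal cliques include one for every choice of a cut rank in each direction, hence r ^ m of
-- them when every family has at least r members.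
--
-- Translates of 2P by p and q meet iff p − q ∈ 2P − 2P, so that other pairs survive small
-- perturbations once the corresponding chord differences lie in the interior of P − P.  A chord
-- spanning d edges with 2d + 3 ≤ k does, because the chord joining the outer neighbours of its
-- ends is a parallel and strictly longer one.  It is longer because two edges fewer than k/2
-- steps apart turn by less than a half turn.  This last fact follows by induction from convexity:
-- with S s the sine of s exterior angles and H u the height of vertex u over edge 0, one has
-- H (2r+1) S (r+1) = S r H (2r+2), where both heights are positive.

module Submission where

open import Defs
open import Algebra.Solver.Ring.AlmostCommutativeRing
  using (AlmostCommutativeRing; fromCommutativeRing; _-Raw-AlmostCommutative⟶_)
import Algebra.Solver.Ring as RingSolver
import Algebra.Properties.CommutativeMonoid.Sum as MonoidSum
import Algebra.Properties.Ring as RingProperties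
import Algebra.Properties.Semiring.Exp as SemiringExp
import Algebra.Properties.Semiring.Mult as SemiringMult
import Algebra.Properties.Semiring.Mult.TCOptimised as SemiringMultTC
open import Data.Bool.Base using (Bool; true; false; not)
open import Data.Empty using (⊥)
open import Data.Fin.Base as Fin using (Fin; zero; suc; toℕ; fromℕ<; finToFun; funToFin)
import Data.Fin.Properties as Fin
open import Data.Fin.Subset as Subset using (Subset; inside; outside)
import Data.Fin.Subset.Properties as Subset
open import Data.Integer.Base as ℤ using (ℤ; +_; -[1+_]; _⊖_; _◃_)
import Data.Integer.Properties as ℤ
open import Data.List.Base using (List; length; lookup)
import Data.List.Membership.Propositional as List
import Data.List.Membership.Propositional.Properties as List
import Data.List.Relation.Unary.Any as Any
open import Data.List.Relation.Unary.Any using (here)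
import Data.List.Relation.Unary.Any.Properties as Any
open import Data.Maybe.Base using (Maybe; just; nothing)
open import Data.Nat.Base as ℕ using (ℕ; zero; suc; NonZero; ⌊_/2⌋; ⌈_/2⌉; _≡ᵇ_)
import Data.Nat.Divisibility as ℕ
open import Data.Nat.DivMod
import Data.Nat.Properties as ℕ
open import Data.Nat.Solver using (module +-*-Solver)
open import Algebra.Properties.CommutativeSemigroup ℕ.+-commutativeSemigroup using (x∙yz≈y∙xz)
open import Data.Product.Base using (_×_; _,_; proj₁; proj₂; Σ-syntax; ∃-syntax)
open import Data.Sign.Base as Sign using (Sign)
open import Data.Sum.Base as Sum using (_⊎_; inj₁; inj₂; [_,_]′)
open import Data.Vec.Base as Vec using (tabulate)
import Data.Vec.Properties as Vec
open import Function.Base using (_∘_; id)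
open import Function.Bundles using (mk⇔)
open import Function.Definitions using (Injective)
open import Level using (0ℓ)
open import Relation.Binary.Bundles using (DecTotalOrder)
import Relation.Binary.Construct.NonStrictToStrict as Strict
open import Relation.Binary.Definitions using (Symmetric; Irreflexive; Decidable; tri<; tri≈; tri>)
open import Relation.Binary.PropositionalEquality.Core as ≡ using (_≡_; _≢_)
open import Relation.Binary.PropositionalEquality.Properties using (module ≡-Reasoning)
import Relation.Binary.Reasoning.PartialOrder as OrderReasoning
open import Relation.Nullary.Decidable using (Dec; yes; no; does; _×-dec_; ¬?; dec-true)
open import Relation.Nullary.Negation using (¬_; contradiction)
open import Relation.Unary using (Pred; _∈_; _≐_; _≬_)

-- Labels, conflicts and cuts

-- One of m directions, a side (false for near, true for far), and a rank.
Label : ℕ → Set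
Label m = Fin m × Bool × ℕ

Crosses : Bool → Bool → ℕ → ℕ → Set
Crosses false true  a b = b ℕ.< a
Crosses true  false a b = a ℕ.< b
Crosses false false a b = ⊥
Crosses true  true  a b = ⊥

Conflict : ∀ {m} → Label m → Label m → Set
Conflict (j , s , a) (j′ , s′ , b) = j ≡ j′ × Crosses s s′ a b

crosses? : ∀ s s′ a b → Dec (Crosses s s′ a b)
crosses? false true  a b = b ℕ.<? a
crosses? true  false a b = a ℕ.<? b
crosses? false false a b = no λ ()
crosses? true  true  a b = no λ ()

conflict? : ∀ {m} → Decidable (Conflict {m})
conflict? (j , s , a) (j′ , s′ , b) = (j Fin.≟ j′) ×-dec crosses? s s′ a b

conflict-sym : ∀ {m} → Symmetric (Conflict {m})
conflict-sym {_} {_ , false , _} {_ , true  , _} (eq , lt) = ≡.sym eq , lt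
conflict-sym {_} {_ , true  , _} {_ , false , _} (eq , lt) = ≡.sym eq , lt

conflict-irrefl : ∀ {m} → Irreflexive _≡_ (Conflict {m})
conflict-irrefl {_} {_ , false , _} ≡.refl (_ , ())
conflict-irrefl {_} {_ , true  , _} ≡.refl (_ , ())

-- Describes the clique belonging to the cut `g`. No near rank in it exceeds a far rank of the same
-- direction, which rules out conflicts.
Within : ∀ {m r} → (Fin m → Fin r) → Label m → Set
Within g (j , false , a) = a ℕ.≤ toℕ (g j)
Within g (j , true  , a) = toℕ (g j) ℕ.≤ a

within? : ∀ {m r} (g : Fin m → Fin r) l → Dec (Within g l)
within? g (j , false , a) = a ℕ.≤? toℕ (g j)
within? g (j , true  , a) = toℕ (g j) ℕ.≤? a

cut : ∀ {m r} → (Fin m → Fin r) → Fin m → Bool → Label m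
cut g j s = j , s , toℕ (g j)

cut-within : ∀ {m r} (g : Fin m → Fin r) j s → Within g (cut g j s)
cut-within g j false = ℕ.≤-refl
cut-within g j true  = ℕ.≤-refl

within⇒¬conflict : ∀ {m r} (g : Fin m → Fin r) l l′ → Within g l → Within g l′ → ¬ Conflict l l′
within⇒¬conflict g (j , false , a) (_ , true  , b) a≤g g≤b (≡.refl , b<a) =
  ℕ.<⇒≱ b<a (ℕ.≤-trans a≤g g≤b)
within⇒¬conflict g (j , true  , a) (_ , false , b) g≤a b≤g (≡.refl , a<b) =
  ℕ.<⇒≱ a<b (ℕ.≤-trans b≤g g≤a)

-- The source of maximality: a label on the wrong side of the cut conflicts with the opposite label
-- at the cut rank, which belongs to the clique.
¬within⇒conflict : ∀ {m r} (g : Fin m → Fin r) l → ¬ Within g l →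
                   Conflict l (cut g (proj₁ l) (not (proj₁ (proj₂ l))))
¬within⇒conflict g (j , false , a) a≰g = ≡.refl , ℕ.≰⇒> a≰g
¬within⇒conflict g (j , true  , a) g≰a = ≡.refl , ℕ.≰⇒> g≰a

-- Numbering the labels, and the graph

[r+q*n]/n≡q : ∀ r q n .{{_ : NonZero n}} → r ℕ.< n → (r ℕ.+ q ℕ.* n) / n ≡ q
[r+q*n]/n≡q r q n r<n = ≡.trans (+-distrib-/-∣ʳ r (ℕ.n∣m*n q))
  (≡.cong₂ ℕ._+_ (m<n⇒m/n≡0 r<n) (m*n/n≡m q n))

[r+q*n]%n≡r : ∀ r q n .{{_ : NonZero n}} → r ℕ.< n → (r ℕ.+ q ℕ.* n) % n ≡ r
[r+q*n]%n≡r r q n r<n = ≡.trans ([m+kn]%n≡m%n r q n) (m<n⇒m%n≡m r<n)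

r+q*n<s*n : ∀ {r q s n} → r ℕ.< n → q ℕ.< s → r ℕ.+ q ℕ.* n ℕ.< s ℕ.* n
r+q*n<s*n {r} {q} {s} {n} r<n q<s = ℕ.<-≤-trans (ℕ.+-monoˡ-< (q ℕ.* n) r<n) (ℕ.*-monoˡ-≤ n q<s)

bit : Bool → ℕ
bit false = 0
bit true  = 1

bit<2 : ∀ s → bit s ℕ.< 2
bit<2 false = ℕ.s≤s ℕ.z≤n
bit<2 true  = ℕ.s≤s (ℕ.s≤s ℕ.z≤n)

bit≡ᵇ1 : ∀ s → (bit s ≡ᵇ 1) ≡ s
bit≡ᵇ1 false = ≡.refl
bit≡ᵇ1 true  = ≡.refl

module _ (m : ℕ) .{{_ : NonZero m}} where

  -- Mixed-radix digits with the rank most significant. The numbers below `n` thus include every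
  -- label of rank below `rankBound n`; the others form one incomplete layer of rank `rankBound n`,
  -- which does not disturb the cliques.
  label : ℕ → Label m
  label i = (i / 2) mod m , (i % 2 ≡ᵇ 1) , i / 2 / m

  code : Label m → ℕ
  code (j , s , a) = bit s ℕ.+ (toℕ j ℕ.+ a ℕ.* m) ℕ.* 2

  label-code : ∀ l → label (code l) ≡ l
  label-code (j , s , a) = ≡.cong₂ _,_
    (Fin.toℕ-injective (≡.trans (Fin.toℕ-fromℕ< _)
      (≡.trans (≡.cong (_% m) half) ([r+q*n]%n≡r (toℕ j) a m (Fin.toℕ<n j)))))
    (≡.cong₂ _,_
      (≡.trans (≡.cong (_≡ᵇ 1) ([r+q*n]%n≡r (bit s) (toℕ j ℕ.+ a ℕ.* m) 2 (bit<2 s))) (bit≡ᵇ1 s))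
      (≡.trans (≡.cong (_/ m) half) ([r+q*n]/n≡q (toℕ j) a m (Fin.toℕ<n j))))
    where
    half : code (j , s , a) / 2 ≡ toℕ j ℕ.+ a ℕ.* m
    half = [r+q*n]/n≡q (bit s) (toℕ j ℕ.+ a ℕ.* m) 2 (bit<2 s)

  rankBound : ℕ → ℕ
  rankBound n = n / 2 / m

  code<n : ∀ {n} j s {a} → a ℕ.< rankBound n → code (j , s , a) ℕ.< n
  code<n {n} j s a<r = ℕ.<-≤-trans
    (r+q*n<s*n (bit<2 s) (ℕ.<-≤-trans (r+q*n<s*n (Fin.toℕ<n j) a<r) (m/n*n≤m (n / 2) m)))
    (m/n*n≤m n 2)

  labelOf : ∀ {n} → Fin n → Label m
  labelOf = label ∘ toℕ

  -- Defined from labels alone, so that cliques can be counted without geometry; the homothets of P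
  -- realise this graph afterwards.
  cliqueGraph : ∀ n → Graph n
  cliqueGraph n = record
    { _~_    = λ i i′ → i ≢ i′ × ¬ Conflict (labelOf i) (labelOf i′)
    ; _~?_   = λ i i′ → ¬? (i Fin.≟ i′) ×-dec ¬? (conflict? (labelOf i) (labelOf i′))
    ; sym    = λ { (i≢i′ , ¬c) → i≢i′ ∘ ≡.sym , ¬c ∘ conflict-sym }
    ; irrefl = λ { ≡.refl (i≢i , _) → i≢i ≡.refl }
    }

  -- One maximal clique for every cut

  module _ (n : ℕ) where
    private
      r : ℕ
      r = rankBound n

    clique : (Fin m → Fin r) → Subset n
    clique g = tabulate λ i → does (within? g (labelOf i))

    ∈-clique⁺ : ∀ g {i} → Within g (labelOf i) → i Subset.∈ clique g
    ∈-clique⁺ g {i} w = Vec.lookup⇒[]= i _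
      (≡.trans (Vec.lookup∘tabulate _ i) (dec-true (within? g (labelOf i)) w))

    ∈-clique⁻ : ∀ g {i} → i Subset.∈ clique g → Within g (labelOf i)
    ∈-clique⁻ g {i} i∈ with within? g (labelOf i)
                          | ≡.trans (≡.sym (Vec.lookup∘tabulate (does ∘ within? g ∘ labelOf) i)) (Vec.[]=⇒lookup i∈)
    ... | yes w | _ = w

    cutVertex : (Fin m → Fin r) → Fin m → Bool → Fin n
    cutVertex g j s = fromℕ< (code<n j s (Fin.toℕ<n (g j)))

    label-cutVertex : ∀ g j s → labelOf (cutVertex g j s) ≡ cut g j s
    label-cutVertex g j s = ≡.trans (≡.cong label (Fin.toℕ-fromℕ< (code<n j s (Fin.toℕ<n (g j))))) (label-code (cut g j s))

    cutVertex∈clique : ∀ g j s → cutVertex g j s Subset.∈ clique g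
    cutVertex∈clique g j s = ∈-clique⁺ g (≡.subst (Within g) (≡.sym (label-cutVertex g j s)) (cut-within g j s))

    clique-isMaximal : ∀ g → IsMaximalClique (cliqueGraph n) (clique g)
    clique-isMaximal g =
        (λ i i′ i∈ i′∈ i≢i′ → i≢i′ , within⇒¬conflict g _ _ (∈-clique⁻ g i∈) (∈-clique⁻ g i′∈))
      , λ T T-clique S⊆T → Subset.⊆-antisym S⊆T λ {i} i∈T → ∈S T-clique S⊆T i∈T
      where
      ∈S : ∀ {T} → IsClique (cliqueGraph n) T → clique g Subset.⊆ T → ∀ {i} → i Subset.∈ T → i Subset.∈ clique g
      ∈S T-clique S⊆T {i} i∈T with within? g (labelOf i)
      ... | yes w = ∈-clique⁺ g w
      -- The cut vertex `w` lies in the clique and hence in `T`, yet conflicts with `i`.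
      -- Irreflexivity of conflicts supplies the `i ≢ w` that the clique property of `T` asks for.
      ... | no ¬w = contradiction conflict
          (proj₂ (T-clique i w i∈T (S⊆T (cutVertex∈clique g j s))
            λ { i≡w → conflict-irrefl (≡.cong labelOf i≡w) conflict }))
        where
        j = proj₁ (labelOf i)
        s = not (proj₁ (proj₂ (labelOf i)))
        w = cutVertex g j s
        conflict : Conflict (labelOf i) (labelOf w)
        conflict = ≡.subst (Conflict (labelOf i)) (≡.sym (label-cutVertex g j s)) (¬within⇒conflict g (labelOf i) ¬w)

    -- Both cut vertices of `g` lie in the clique of `g′`: the near one gives `g j` ≤ `g′ j`, the
    -- far one the converse.
    clique-injective : ∀ {g g′} → clique g ≡ clique g′ → ∀ j → g j ≡ g′ j
    clique-injective {g} {g′} eq j = Fin.toℕ-injective (ℕ.≤-antisym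
        (within false) (within true))
      where
      within : ∀ s → Within g′ (cut g j s)
      within s = ≡.subst (Within g′) (label-cutVertex g j s)
        (∈-clique⁻ g′ (≡.subst (cutVertex g j s Subset.∈_) eq (cutVertex∈clique g j s)))

  -- Counting the maximal cliques

  ∈-subsets : ∀ {n} (S : Subset n) → S List.∈ subsets n
  ∈-subsets Vec.[]            = here ≡.refl
  ∈-subsets (inside  Vec.∷ S) = List.∈-++⁺ˡ (List.∈-map⁺ _ (∈-subsets S))
  ∈-subsets (outside Vec.∷ S) = List.∈-++⁺ʳ _ (List.∈-map⁺ _ (∈-subsets S))

  injective⇒≤length : ∀ {A : Set} {xs : List A} {p} (f : Fin p → A) → Injective _≡_ _≡_ f →
                      (∀ i → f i List.∈ xs) → p ℕ.≤ length xs
  injective⇒≤length {xs = xs} f f-inj f∈ = Fin.injective⇒≤ {f = λ i → Any.index (f∈ i)} λ {i} {j} eq →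
    f-inj (≡.trans (Any.lookup-index (f∈ i)) (≡.trans (≡.cong (lookup xs) eq) (≡.sym (Any.lookup-index (f∈ j)))))

  -- Cuts are recovered from their cliques only pointwise; encoding them as numbers turns this into
  -- an equality without function extensionality.
  funToFin-cong : ∀ {p q} {f g : Fin p → Fin q} → (∀ i → f i ≡ g i) → funToFin f ≡ funToFin g
  funToFin-cong {zero}  eq = ≡.refl
  funToFin-cong {suc p} eq = ≡.cong₂ Fin.combine (eq Fin.zero) (funToFin-cong (eq ∘ Fin.suc))

  #maximalCliques-≥ : ∀ n → rankBound n ℕ.^ m ℕ.≤ #maximalCliques (cliqueGraph n)
  #maximalCliques-≥ n = injective⇒≤length (clique n ∘ finToFun)
    (λ {i} {j} eq → ≡.trans (≡.sym (Fin.funToFin-finToFin {m} i))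
      (≡.trans (funToFin-cong (clique-injective n eq)) (Fin.funToFin-finToFin {m} j)))
    λ i → List.∈-filter⁺ (isMaximalClique? (cliqueGraph n)) (∈-subsets _) (clique-isMaximal n _)

-- Arithmetic in an ordered field

module OrderedField (ℝ : CompleteOrderedField) where
  open CompleteOrderedField ℝ
  open DecTotalOrder decTotalOrder public
    using (poset; total; _≤?_; antisym; ≤-respˡ-≈; ≤-respʳ-≈)
    renaming (refl to ≤-refl; reflexive to ≤-reflexive; trans to ≤-trans)
  open RingProperties ring
    using (-1*x≈-x; -‿involutive)
  open SemiringMult semiring using (×-homo-+; ×1-homo-*)
  open SemiringMultTC semiring using (1+×) renaming
    (_×_ to _×′_; ×-homo-+ to ×′-homo-+; ×1-homo-* to ×′1-homo-*)

  module ≤-Reasoning = OrderReasoning poset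

  module Solver where

    almostCommutativeRing : AlmostCommutativeRing _ _
    almostCommutativeRing = fromCommutativeRing commutativeRing

    private
      module A = AlmostCommutativeRing almostCommutativeRing

    -- The optimised multiples `_×′_` make the literals 0 and 1 reduce to `0#` and `1#`, so that
    -- solved equations match the field expressions as written.
    fromℤ : ℤ → Carrier
    fromℤ (+ n)    = n ×′ 1#
    fromℤ -[1+ n ] = - (suc n ×′ 1#)

    sgn : Sign → Carrier
    sgn Sign.+ = 1#
    sgn Sign.- = - 1#

    open ≤-Reasoning

    -0≈0 : - 0# ≈ 0#
    -0≈0 = trans (sym (+-identityˡ _)) (-‿inverseʳ 0#)

    fromℤ-⊖ : ∀ m n → fromℤ (m ⊖ n) ≈ m ×′ 1# + - (n ×′ 1#)
    fromℤ-⊖ m       zero    = trans (sym (+-identityʳ _)) (+-congˡ (sym -0≈0))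
    fromℤ-⊖ zero    (suc n) = sym (+-identityˡ _)
    fromℤ-⊖ (suc m) (suc n) = begin-equality
      fromℤ (suc m ⊖ suc n)                       ≡⟨ ≡.cong fromℤ (ℤ.[1+m]⊖[1+n]≡m⊖n m n) ⟩
      fromℤ (m ⊖ n)                               ≈⟨ fromℤ-⊖ m n ⟩
      m ×′ 1# + - (n ×′ 1#)                       ≈⟨ +-congʳ (+-identityʳ _) ⟨
      m ×′ 1# + 0# + - (n ×′ 1#)                  ≈⟨ +-congʳ (+-congˡ (-‿inverseʳ 1#)) ⟨
      m ×′ 1# + (1# + - 1#) + - (n ×′ 1#)         ≈⟨ +-congʳ (+-assoc _ _ _) ⟨
      m ×′ 1# + 1# + - 1# + - (n ×′ 1#)           ≈⟨ +-assoc _ _ _ ⟩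
      m ×′ 1# + 1# + (- 1# + - (n ×′ 1#))         ≈⟨ +-cong (+-comm _ _) (A.-‿+-comm _ _) ⟩
      1# + m ×′ 1# + - (1# + n ×′ 1#)             ≈⟨ +-cong (1+× m 1#) (-‿cong (1+× n 1#)) ⟨
      suc m ×′ 1# + - (suc n ×′ 1#)               ∎

    fromℤ-+ : ∀ i j → fromℤ (i ℤ.+ j) ≈ fromℤ i + fromℤ j
    fromℤ-+ (+ m)    (+ n)    = ×′-homo-+ 1# m n
    fromℤ-+ (+ m)    -[1+ n ] = fromℤ-⊖ m (suc n)
    fromℤ-+ -[1+ m ] (+ n)    = trans (fromℤ-⊖ n (suc m)) (+-comm _ _)
    fromℤ-+ -[1+ m ] -[1+ n ] = begin-equality
      - (suc (suc (m ℕ.+ n)) ×′ 1#)         ≡⟨ ≡.cong (λ u → - (suc u ×′ 1#)) (ℕ.+-suc m n) ⟨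
      - ((suc m ℕ.+ suc n) ×′ 1#)           ≈⟨ -‿cong (×′-homo-+ 1# (suc m) (suc n)) ⟩
      - (suc m ×′ 1# + suc n ×′ 1#)         ≈⟨ A.-‿+-comm _ _ ⟨
      - (suc m ×′ 1#) + - (suc n ×′ 1#)     ∎

    fromℤ-◃ : ∀ s n → fromℤ (s ◃ n) ≈ sgn s * (n ×′ 1#)
    fromℤ-◃ s      zero    = sym (zeroʳ _)
    fromℤ-◃ Sign.+ (suc n) = sym (*-identityˡ _)
    fromℤ-◃ Sign.- (suc n) = sym (-1*x≈-x _)

    fromℤ-sign : ∀ i → fromℤ i ≈ sgn (ℤ.sign i) * (ℤ.∣ i ∣ ×′ 1#)
    fromℤ-sign i = trans (reflexive (≡.cong fromℤ (≡.sym (ℤ.signᵢ◃∣i∣≡i i)))) (fromℤ-◃ (ℤ.sign i) ℤ.∣ i ∣)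

    sgn-* : ∀ s t → sgn (s Sign.* t) ≈ sgn s * sgn t
    sgn-* Sign.+ t      = sym (*-identityˡ _)
    sgn-* Sign.- Sign.+ = sym (*-identityʳ _)
    sgn-* Sign.- Sign.- = sym (trans (-1*x≈-x _) (-‿involutive 1#))

    *-interchange : ∀ a b c d → (a * b) * (c * d) ≈ (a * c) * (b * d)
    *-interchange a b c d = begin-equality
      a * b * (c * d)   ≈⟨ *-assoc a b _ ⟩
      a * (b * (c * d)) ≈⟨ *-congˡ (*-assoc b c d) ⟨
      a * (b * c * d)   ≈⟨ *-congˡ (*-congʳ (*-comm b c)) ⟩
      a * (c * b * d)   ≈⟨ *-congˡ (*-assoc c b d) ⟩
      a * (c * (b * d)) ≈⟨ *-assoc a c _ ⟨
      a * c * (b * d)   ∎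

    fromℤ-* : ∀ i j → fromℤ (i ℤ.* j) ≈ fromℤ i * fromℤ j
    fromℤ-* i j = begin-equality
      fromℤ (s Sign.* t ◃ a ℕ.* b)                 ≈⟨ fromℤ-◃ (s Sign.* t) (a ℕ.* b) ⟩
      sgn (s Sign.* t) * ((a ℕ.* b) ×′ 1#)         ≈⟨ *-cong (sgn-* s t) (×′1-homo-* a b) ⟩
      sgn s * sgn t * (a ×′ 1# * (b ×′ 1#))        ≈⟨ *-interchange _ _ _ _ ⟩
      sgn s * (a ×′ 1#) * (sgn t * (b ×′ 1#))      ≈⟨ *-cong (fromℤ-sign i) (fromℤ-sign j) ⟨
      fromℤ i * fromℤ j                            ∎
      where
      s = ℤ.sign i
      t = ℤ.sign j
      a = ℤ.∣ i ∣
      b = ℤ.∣ j ∣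

    fromℤ-neg : ∀ i → fromℤ (ℤ.- i) ≈ - fromℤ i
    fromℤ-neg (+ zero)  = sym -0≈0
    fromℤ-neg (+ suc n) = refl
    fromℤ-neg -[1+ n ]  = sym (-‿involutive _)

    morphism : ℤ.+-*-rawRing -Raw-AlmostCommutative⟶ almostCommutativeRing
    morphism = record
      { ⟦_⟧    = fromℤ
      ; +-homo = fromℤ-+
      ; *-homo = fromℤ-*
      ; -‿homo = fromℤ-neg
      ; 0-homo = refl
      ; 1-homo = refl
      }

    weak≟ : ∀ i j → Maybe (fromℤ i ≈ fromℤ j)
    weak≟ i j with i ℤ.≟ j
    ... | yes eq = just (reflexive (≡.cong fromℤ eq))
    ... | no  _  = nothing

    open RingSolver ℤ.+-*-rawRing almostCommutativeRing morphism weak≟ public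
      using (solve; con; _:=_; _:+_; _:*_; :-_; _:-_)

  open Solver using (solve; con; _:=_; _:+_; _:*_; :-_; _:-_)

  <⇒≱ : ∀ {x y} → x < y → ¬ (y ≤ x)
  <⇒≱ = Strict.<⇒≱ _≈_ _≤_ antisym

  ≰⇒> : ∀ {x y} → ¬ (x ≤ y) → y < x
  ≰⇒> = Strict.≰⇒> _≈_ _≤_ sym ≤-reflexive total

  <-respʳ : ∀ {x y z} → y ≈ z → x < y → x < z
  <-respʳ = Strict.<-respʳ-≈ _≈_ _≤_ sym trans ≤-respʳ-≈

  open ≤-Reasoning

  +-monoˡ-≤ : ∀ z {x y} → x ≤ y → x + z ≤ y + z
  +-monoˡ-≤ z {x} {y} x≤y = begin
    x + z ≈⟨ +-comm x z ⟩
    z + x ≤⟨ +-monoʳ-≤ z x≤y ⟩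
    z + y ≈⟨ +-comm z y ⟩
    y + z ∎

  +-mono-≤ : ∀ {x y u v} → x ≤ y → u ≤ v → x + u ≤ y + v
  +-mono-≤ {x} {y} {u} {v} x≤y u≤v = ≤-trans (+-monoˡ-≤ u x≤y) (+-monoʳ-≤ y u≤v)

  x≤y⇒0≤y-x : ∀ {x y} → x ≤ y → 0# ≤ y - x
  x≤y⇒0≤y-x {x} x≤y = ≤-respˡ-≈ (-‿inverseʳ x) (+-monoˡ-≤ (- x) x≤y)

  ≤-by : ∀ {x y z} → 0# ≤ z → y ≈ x + z → x ≤ y
  ≤-by {x} {y} {z} 0≤z eq = begin
    x      ≈⟨ +-identityʳ x ⟨
    x + 0# ≤⟨ +-monoʳ-≤ x 0≤z ⟩
    x + z  ≈⟨ eq ⟨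
    y      ∎

  0≤y-x⇒x≤y : ∀ {x y} → 0# ≤ y - x → x ≤ y
  0≤y-x⇒x≤y {x} {y} le = ≤-by le (solve 2 (λ x y → y := x :+ (y :- x)) refl x y)

  x<y⇒0<y-x : ∀ {x y} → x < y → 0# < y - x
  x<y⇒0<y-x {x} {y} (x≤y , x≉y) = x≤y⇒0≤y-x x≤y , λ eq → x≉y (begin-equality
    x           ≈⟨ +-identityʳ x ⟨
    x + 0#      ≈⟨ +-congˡ eq ⟩
    x + (y - x) ≈⟨ solve 2 (λ x y → y := x :+ (y :- x)) refl x y ⟨
    y           ∎)

  <-by : ∀ {x y z} → 0# < z → y ≈ x + z → x < y
  <-by {x} {y} {z} (0≤z , 0≉z) eq = ≤-by 0≤z eq , λ x≈y → 0≉z (begin-equality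
    0#          ≈⟨ -‿inverseʳ x ⟨
    x - x       ≈⟨ +-congʳ (trans x≈y eq) ⟩
    x + z - x   ≈⟨ solve 2 (λ x z → x :+ z :- x := z) refl x z ⟩
    z           ∎)

  *-monoˡ-≤ : ∀ {x y z} → 0# ≤ z → x ≤ y → z * x ≤ z * y
  *-monoˡ-≤ {x} {y} {z} 0≤z x≤y = ≤-by (*-nonNeg 0≤z (x≤y⇒0≤y-x x≤y))
    (solve 3 (λ x y z → z :* y := z :* x :+ z :* (y :- x)) refl x y z)

  *-monoʳ-≤ : ∀ {x y z} → 0# ≤ z → x ≤ y → x * z ≤ y * z
  *-monoʳ-≤ {x} {y} {z} 0≤z x≤y =
    ≤-respˡ-≈ (*-comm z x) (≤-respʳ-≈ (*-comm z y) (*-monoˡ-≤ 0≤z x≤y))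

  *-cancelˡ-0 : ∀ {x y} → ¬ (x ≈ 0#) → x * y ≈ 0# → y ≈ 0#
  *-cancelˡ-0 {x} {y} x≉0 eq with inverse x x≉0
  ... | w , xw≈1 = begin-equality
    y           ≈⟨ *-identityˡ y ⟨
    1# * y      ≈⟨ *-congʳ xw≈1 ⟨
    x * w * y   ≈⟨ solve 3 (λ x y w → x :* w :* y := w :* (x :* y)) refl x y w ⟩
    w * (x * y) ≈⟨ *-congˡ eq ⟩
    w * 0#      ≈⟨ zeroʳ w ⟩
    0#          ∎

  0<⇒≉0 : ∀ {x} → 0# < x → ¬ (x ≈ 0#)
  0<⇒≉0 (_ , 0≉x) x≈0 = 0≉x (sym x≈0)

  *-pos : ∀ {x y} → 0# < x → 0# < y → 0# < x * y
  *-pos 0<x 0<y = *-nonNeg (proj₁ 0<x) (proj₁ 0<y) ,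
    λ eq → 0<⇒≉0 0<y (*-cancelˡ-0 (0<⇒≉0 0<x) (sym eq))

  +-pos-nonNeg : ∀ {x y} → 0# < x → 0# ≤ y → 0# < x + y
  +-pos-nonNeg {x} {y} 0<x 0≤y = begin-strict
    0#     <⟨ 0<x ⟩
    x      ≤⟨ ≤-by 0≤y refl ⟩
    x + y  ∎

  +-nonNeg : ∀ {x y} → 0# ≤ x → 0# ≤ y → 0# ≤ x + y
  +-nonNeg 0≤x 0≤y = ≤-trans 0≤x (≤-by 0≤y refl)

  x≤0⇒0≤-x : ∀ {x} → x ≤ 0# → 0# ≤ - x
  x≤0⇒0≤-x {x} x≤0 = ≤-respʳ-≈ (+-identityˡ (- x)) (x≤y⇒0≤y-x x≤0)

  x²-nonNeg : ∀ x → 0# ≤ x * x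
  x²-nonNeg x with total 0# x
  ... | inj₁ 0≤x = *-nonNeg 0≤x 0≤x
  ... | inj₂ x≤0 = ≤-respʳ-≈ (solve 1 (λ x → :- x :* :- x := x :* x) refl x)
    (*-nonNeg (x≤0⇒0≤-x x≤0) (x≤0⇒0≤-x x≤0))

  0≤1 : 0# ≤ 1#
  0≤1 = ≤-respʳ-≈ (*-identityˡ 1#) (x²-nonNeg 1#)

  0<1 : 0# < 1#
  0<1 = 0≤1 , 0≉1

  *-cancelˡ-≤ : ∀ {x y z} → 0# < z → z * x ≤ z * y → x ≤ y
  *-cancelˡ-≤ {x} {y} {z} 0<z le with x ≤? y
  ... | yes x≤y = x≤y
  ... | no  x≰y = contradiction le (<⇒≱ (<-by (*-pos 0<z (x<y⇒0<y-x (≰⇒> x≰y)))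
    (solve 3 (λ x y z → z :* x := z :* y :+ z :* (x :- y)) refl x y z)))

  pos-factor : ∀ {x y} → 0# < x → 0# < x * y → 0# < y
  pos-factor {x} {y} 0<x (0≤xy , 0≉xy) =
    *-cancelˡ-≤ 0<x (≤-respˡ-≈ (sym (zeroʳ x)) 0≤xy) ,
    λ 0≈y → 0≉xy (trans (sym (zeroʳ x)) (*-congˡ 0≈y))

  *-cancelˡ : ∀ {x y z} → 0# < z → z * x ≈ z * y → x ≈ y
  *-cancelˡ 0<z eq = antisym (*-cancelˡ-≤ 0<z (≤-reflexive eq))
                             (*-cancelˡ-≤ 0<z (≤-reflexive (sym eq)))

  pos-inverse : ∀ {x} → 0# < x → ∃[ y ] 0# < y × x * y ≈ 1#
  pos-inverse {x} 0<x with inverse x (0<⇒≉0 0<x)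
  ... | y , xy≈1 = y , pos-factor 0<x (<-respʳ (sym xy≈1) 0<1) , xy≈1

  pos-square-injective : ∀ {x y} → 0# < x → 0# < y → x * x ≈ y * y → x ≈ y
  pos-square-injective {x} {y} 0<x 0<y eq = begin-equality
    x           ≈⟨ solve 2 (λ x y → x := y :+ (x :- y)) refl x y ⟩
    y + (x - y) ≈⟨ +-congˡ (*-cancelˡ-0 (0<⇒≉0 (+-pos-nonNeg 0<x (proj₁ 0<y))) (begin-equality
      (x + y) * (x - y) ≈⟨ solve 2 (λ x y → (x :+ y) :* (x :- y) := x :* x :- y :* y) refl x y ⟩
      x * x - y * y     ≈⟨ +-congʳ eq ⟩
      y * y - y * y     ≈⟨ -‿inverseʳ _ ⟩
      0#                ∎)) ⟩
    y + 0#      ≈⟨ +-identityʳ y ⟩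
    y           ∎

  fromℕ-+ : ∀ m n → fromℕ (m ℕ.+ n) ≈ fromℕ m + fromℕ n
  fromℕ-+ = ×-homo-+ 1#

  fromℕ-* : ∀ m n → fromℕ (m ℕ.* n) ≈ fromℕ m * fromℕ n
  fromℕ-* = ×1-homo-*

  fromℕ-^ : ∀ m n → fromℕ (m ℕ.^ n) ≈ fromℕ m ^ n
  fromℕ-^ m zero    = +-identityʳ 1#
  fromℕ-^ m (suc n) = trans (fromℕ-* m (m ℕ.^ n)) (*-congˡ (fromℕ-^ m n))

  fromℕ-nonNeg : ∀ n → 0# ≤ fromℕ n
  fromℕ-nonNeg zero    = ≤-refl
  fromℕ-nonNeg (suc n) = +-nonNeg 0≤1 (fromℕ-nonNeg n)

  fromℕ-pos : ∀ n .{{_ : NonZero n}} → 0# < fromℕ n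
  fromℕ-pos (suc n) = +-pos-nonNeg 0<1 (fromℕ-nonNeg n)

  fromℕ-mono-≤ : ∀ {m n} → m ℕ.≤ n → fromℕ m ≤ fromℕ n
  fromℕ-mono-≤ {n = n} ℕ.z≤n = fromℕ-nonNeg n
  fromℕ-mono-≤ (ℕ.s≤s m≤n)   = +-monoʳ-≤ 1# (fromℕ-mono-≤ m≤n)

  fromℕ-cancel-≤ : ∀ {m n} → fromℕ m ≤ fromℕ n → m ℕ.≤ n
  fromℕ-cancel-≤ {zero}          _  = ℕ.z≤n
  fromℕ-cancel-≤ {suc m} {zero}  le = contradiction le (<⇒≱ (fromℕ-pos (suc m)))
  fromℕ-cancel-≤ {suc m} {suc n} le = ℕ.s≤s (fromℕ-cancel-≤ (0≤y-x⇒x≤y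
    (≤-respʳ-≈ (solve 3 (λ o a b → (o :+ b) :- (o :+ a) := b :- a) refl 1# (fromℕ m) (fromℕ n))
               (x≤y⇒0≤y-x le))))

  ^-pos : ∀ {x} → 0# < x → ∀ n → 0# < x ^ n
  ^-pos 0<x zero    = 0<1
  ^-pos 0<x (suc n) = *-pos 0<x (^-pos 0<x n)

  ^-mono-≤ : ∀ {x y} → 0# ≤ x → x ≤ y → ∀ n → x ^ n ≤ y ^ n
  ^-mono-≤ 0≤x x≤y zero    = ≤-refl
  ^-mono-≤ {x} {y} 0≤x x≤y (suc n) = begin
    x * x ^ n ≤⟨ *-monoˡ-≤ 0≤x (^-mono-≤ 0≤x x≤y n) ⟩
    x * y ^ n ≤⟨ *-monoʳ-≤ (^-nonNeg (≤-trans 0≤x x≤y) n) x≤y ⟩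
    y * y ^ n ∎
    where
    ^-nonNeg : ∀ {x} → 0# ≤ x → ∀ n → 0# ≤ x ^ n
    ^-nonNeg 0≤x zero    = 0≤1
    ^-nonNeg 0≤x (suc n) = *-nonNeg 0≤x (^-nonNeg 0≤x n)

  ^-cancel-≤ : ∀ {x y} n → 0# ≤ y → x ^ suc n ≤ y ^ suc n → x ≤ y
  ^-cancel-≤ {x} {y} n 0≤y le with x ≤? y
  ... | yes x≤y = x≤y
  ... | no  x≰y = contradiction le (<⇒≱ (begin-strict
    y * y ^ n ≤⟨ *-monoˡ-≤ 0≤y (^-mono-≤ 0≤y (proj₁ y<x) n) ⟩
    y * x ^ n <⟨ <-by (*-pos (x<y⇒0<y-x y<x) (^-pos (≤-<-trans 0≤y y<x) n))
                   (solve 3 (λ x y z → x :* z := y :* z :+ (x :- y) :* z) refl x y (x ^ n)) ⟩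
    x * x ^ n ∎))
    where
    y<x = ≰⇒> x≰y
    ≤-<-trans : ∀ {a b c} → a ≤ b → b < c → a < c
    ≤-<-trans = Strict.≤-<-trans _≈_ _≤_ ≤-trans antisym ≤-respˡ-≈

  ^-distrib-* : ∀ x y n → (x * y) ^ n ≈ x ^ n * y ^ n
  ^-distrib-* x y zero    = sym (*-identityˡ 1#)
  ^-distrib-* x y (suc n) = trans (*-congˡ (^-distrib-* x y n))
    (solve 4 (λ x y a b → x :* y :* (a :* b) := x :* a :* (y :* b)) refl x y (x ^ n) (y ^ n))

  -- For nonnegative `x` let s be the supremum of the naturals not above `x`. Some such n exceeds s
  -- - 1; then n + 1 exceeds s, so it is not among them.
  archimedean : ∀ x → ∃[ n ] x ≤ fromℕ n
  archimedean x with total x 0#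
  ... | inj₁ x≤0 = 0 , x≤0
  ... | inj₂ 0≤x with supremum (λ y → ∃[ n ] y ≈ fromℕ n × fromℕ n ≤ x) (0# , 0 , refl , 0≤x)
                        (x , λ { y (n , y≈n , n≤x) → ≤-respˡ-≈ (sym y≈n) n≤x })
  ... | s , ub , approx with approx (s - 1#)
      (<-by 0<1 (solve 2 (λ s o → s := s :- o :+ o) refl s 1#))
  ... | z , (n , z≈n , n≤x) , s-1<z with total x (fromℕ (suc n))
  ... | inj₁ x≤sn = suc n , x≤sn
  ... | inj₂ sn≤x = contradiction (begin
      z               ≈⟨ z≈n ⟩
      fromℕ n         ≈⟨ solve 2 (λ n o → n := o :+ n :- o) refl (fromℕ n) 1# ⟩
      fromℕ (suc n) - 1# ≤⟨ +-monoˡ-≤ (- 1#) (ub _ (suc n , refl , sn≤x)) ⟩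
      s - 1#          ∎) (<⇒≱ s-1<z)

-- Cross products, rotations and regular vertex sequences

module CrossProduct (ℝ : CompleteOrderedField) where
  open CompleteOrderedField ℝ
  open OrderedField ℝ
  open Plane ℝ
  open Solver using (solve; con; _:=_; _:+_; _:*_; :-_; _:-_)

  ≈ₚ-refl : ∀ {p} → p ≈ₚ p
  ≈ₚ-refl = refl , refl

  ≈ₚ-sym : ∀ {p q} → p ≈ₚ q → q ≈ₚ p
  ≈ₚ-sym (eq₁ , eq₂) = sym eq₁ , sym eq₂

  ≈ₚ-trans : ∀ {p q r} → p ≈ₚ q → q ≈ₚ r → p ≈ₚ r
  ≈ₚ-trans (eq₁ , eq₂) (eq₁′ , eq₂′) = trans eq₁ eq₁′ , trans eq₂ eq₂′

  cross-cong : ∀ {p p′ q q′} → p ≈ₚ p′ → q ≈ₚ q′ → cross p q ≈ cross p′ q′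
  cross-cong (eq₁ , eq₂) (eq₁′ , eq₂′) = +-cong (*-cong eq₁ eq₂′) (-‿cong (*-cong eq₂ eq₁′))

  cross-swap : ∀ p q → cross p q ≈ - cross q p
  cross-swap (p₁ , p₂) (q₁ , q₂) = solve 4 (λ p₁ p₂ q₁ q₂ →
    p₁ :* q₂ :- p₂ :* q₁ := :- (q₁ :* p₂ :- q₂ :* p₁)) refl p₁ p₂ q₁ q₂

  cross-self : ∀ p → cross p p ≈ 0#
  cross-self (p₁ , p₂) = solve 2 (λ p₁ p₂ → p₁ :* p₂ :- p₂ :* p₁ := con (+ 0)) refl p₁ p₂

  cross-0ʳ : ∀ a p → cross a (p -ₚ p) ≈ 0#
  cross-0ʳ (a₁ , a₂) (p₁ , p₂) = solve 4 (λ a₁ a₂ p₁ p₂ →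
    a₁ :* (p₂ :- p₂) :- a₂ :* (p₁ :- p₁) := con (+ 0)) refl a₁ a₂ p₁ p₂

  cross-splitʳ : ∀ a p q r → cross a (r -ₚ p) ≈ cross a (q -ₚ p) + cross a (r -ₚ q)
  cross-splitʳ (a₁ , a₂) (p₁ , p₂) (q₁ , q₂) (r₁ , r₂) = solve 8 (λ a₁ a₂ p₁ p₂ q₁ q₂ r₁ r₂ →
    a₁ :* (r₂ :- p₂) :- a₂ :* (r₁ :- p₁)
      := (a₁ :* (q₂ :- p₂) :- a₂ :* (q₁ :- p₁)) :+ (a₁ :* (r₂ :- q₂) :- a₂ :* (r₁ :- q₁)))
    refl a₁ a₂ p₁ p₂ q₁ q₂ r₁ r₂

  cross-splitˡ : ∀ a p q r → cross (r -ₚ p) a ≈ cross (q -ₚ p) a + cross (r -ₚ q) a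
  cross-splitˡ (a₁ , a₂) (p₁ , p₂) (q₁ , q₂) (r₁ , r₂) = solve 8 (λ a₁ a₂ p₁ p₂ q₁ q₂ r₁ r₂ →
    (r₁ :- p₁) :* a₂ :- (r₂ :- p₂) :* a₁
      := ((q₁ :- p₁) :* a₂ :- (q₂ :- p₂) :* a₁) :+ ((r₁ :- q₁) :* a₂ :- (r₂ :- q₂) :* a₁))
    refl a₁ a₂ p₁ p₂ q₁ q₂ r₁ r₂

  cross-*ₚ : ∀ s p q → cross (s *ₚ p) (s *ₚ q) ≈ (s * s) * cross p q
  cross-*ₚ s (p₁ , p₂) (q₁ , q₂) = solve 5 (λ s p₁ p₂ q₁ q₂ →
    s :* p₁ :* (s :* q₂) :- s :* p₂ :* (s :* q₁) := s :* s :* (p₁ :* q₂ :- p₂ :* q₁))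
    refl s p₁ p₂ q₁ q₂

  -- Lagrange's identity, the polynomial form of cos² + sin² = 1.
  lagrange : ∀ p q → dot p p * dot q q ≈ dot p q * dot p q + cross p q * cross p q
  lagrange (p₁ , p₂) (q₁ , q₂) = solve 4 (λ p₁ p₂ q₁ q₂ →
    (p₁ :* p₁ :+ p₂ :* p₂) :* (q₁ :* q₁ :+ q₂ :* q₂)
      := (p₁ :* q₁ :+ p₂ :* q₂) :* (p₁ :* q₁ :+ p₂ :* q₂)
         :+ (p₁ :* q₂ :- p₂ :* q₁) :* (p₁ :* q₂ :- p₂ :* q₁)) refl p₁ p₂ q₁ q₂

  -- The three-term Plücker relation among the 2 × 2 minors of four plane vectors.
  plücker : ∀ a b y z → cross b y * cross a z ≈ cross b z * cross a y + cross a b * cross z y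
  plücker (a₁ , a₂) (b₁ , b₂) (y₁ , y₂) (z₁ , z₂) = solve 8 (λ a₁ a₂ b₁ b₂ y₁ y₂ z₁ z₂ →
    (b₁ :* y₂ :- b₂ :* y₁) :* (a₁ :* z₂ :- a₂ :* z₁)
      := (b₁ :* z₂ :- b₂ :* z₁) :* (a₁ :* y₂ :- a₂ :* y₁)
         :+ (a₁ :* b₂ :- a₂ :* b₁) :* (z₁ :* y₂ :- z₂ :* y₁)) refl a₁ a₂ b₁ b₂ y₁ y₂ z₁ z₂

  -- Cramer's rule for `w` in the basis `a`, `c`, cleared of denominators.
  cramer : ∀ a c w → cross a c *ₚ w ≈ₚ cross w c *ₚ a +ₚ cross a w *ₚ c
  cramer (a₁ , a₂) (c₁ , c₂) (w₁ , w₂) =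
      solve 6 (λ a₁ a₂ c₁ c₂ w₁ w₂ → (a₁ :* c₂ :- a₂ :* c₁) :* w₁
        := (w₁ :* c₂ :- w₂ :* c₁) :* a₁ :+ (a₁ :* w₂ :- a₂ :* w₁) :* c₁) refl a₁ a₂ c₁ c₂ w₁ w₂
    , solve 6 (λ a₁ a₂ c₁ c₂ w₁ w₂ → (a₁ :* c₂ :- a₂ :* c₁) :* w₂
        := (w₁ :* c₂ :- w₂ :* c₁) :* a₂ :+ (a₁ :* w₂ :- a₂ :* w₁) :* c₂) refl a₁ a₂ c₁ c₂ w₁ w₂

  -- Multiplication by the complex number `c` + i `s`: a rotation combined with a scaling, which
  -- avoids normalising by a square root.
  rotate : Carrier → Carrier → Point → Point
  rotate c s (x , y) = c * x - s * y , s * x + c * y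

  rotate-cong : ∀ {c c′ s s′} p → c ≈ c′ → s ≈ s′ → rotate c s p ≈ₚ rotate c′ s′ p
  rotate-cong p c≈c′ s≈s′ = +-cong (*-congʳ c≈c′) (-‿cong (*-congʳ s≈s′)) ,
                            +-cong (*-congʳ s≈s′) (*-congʳ c≈c′)

  cross-rotate : ∀ c s p q → cross (rotate c s p) (rotate c s q) ≈ (c * c + s * s) * cross p q
  cross-rotate c s (p₁ , p₂) (q₁ , q₂) = solve 6 (λ c s p₁ p₂ q₁ q₂ →
    (c :* p₁ :- s :* p₂) :* (s :* q₁ :+ c :* q₂) :- (s :* p₁ :+ c :* p₂) :* (c :* q₁ :- s :* q₂)
      := (c :* c :+ s :* s) :* (p₁ :* q₂ :- p₂ :* q₁)) refl c s p₁ p₂ q₁ q₂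

  -- In complex terms |p|² q = (p̄ q) p, where p̄ q has real part `dot p q` and imaginary part
  -- `cross p q`.
  rotate-dot-cross : ∀ p q → dot p p *ₚ q ≈ₚ rotate (dot p q) (cross p q) p
  rotate-dot-cross (p₁ , p₂) (q₁ , q₂) =
      solve 4 (λ p₁ p₂ q₁ q₂ → (p₁ :* p₁ :+ p₂ :* p₂) :* q₁
        := (p₁ :* q₁ :+ p₂ :* q₂) :* p₁ :- (p₁ :* q₂ :- p₂ :* q₁) :* p₂) refl p₁ p₂ q₁ q₂
    , solve 4 (λ p₁ p₂ q₁ q₂ → (p₁ :* p₁ :+ p₂ :* p₂) :* q₂
        := (p₁ :* q₂ :- p₂ :* q₁) :* p₁ :+ (p₁ :* q₁ :+ p₂ :* q₂) :* p₂) refl p₁ p₂ q₁ q₂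

  edges : (ℕ → Point) → ℕ → Point
  edges V i = V (suc i) -ₚ V i

  -- The vertices are unrolled into a periodic sequence so that indices add without reduction modulo
  -- `k`.
  record RegularSequence (k : ℕ) (V : ℕ → Point) : Set where
    private
      e = edges V
    field
      3≤k         : 3 ℕ.≤ k
      periodic    : ∀ i → V (k ℕ.+ i) ≡ V i
      convex      : ∀ i u → 2 ℕ.≤ u → u ℕ.< k → 0# < cross (e i) (V (u ℕ.+ i) -ₚ V i)
      equilateral : ∀ i j → dot (e i) (e i) ≈ dot (e j) (e j)
      equiangular : ∀ i j → dot (e i) (e (suc i)) ≈ dot (e j) (e (suc j))

-- Sines of exterior angles and heights of vertices

module Turning (ℝ : CompleteOrderedField) {k : ℕ} {V : ℕ → Plane.Point ℝ}
  (regular : CrossProduct.RegularSequence ℝ k V) where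
  open CompleteOrderedField ℝ
  open Plane ℝ
  open OrderedField ℝ
  open CrossProduct ℝ
  open RegularSequence regular
  open Solver using (solve; con; _:=_; _:+_; _:*_; :-_; _:-_)
  open ≤-Reasoning

  e : ℕ → Point
  e = edges V

  cross-consecutive-pos : ∀ i → 0# < cross (e i) (e (suc i))
  cross-consecutive-pos i = <-respʳ (begin-equality
    cross (e i) (V (2 ℕ.+ i) -ₚ V i)              ≈⟨ cross-splitʳ (e i) (V i) (V (suc i)) (V (2 ℕ.+ i)) ⟩
    cross (e i) (e i) + cross (e i) (e (suc i))   ≈⟨ +-congʳ (cross-self (e i)) ⟩
    0# + cross (e i) (e (suc i))                  ≈⟨ +-identityˡ _ ⟩
    cross (e i) (e (suc i))                       ∎)
    (convex i 2 ℕ.≤-refl 3≤k)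

  -- By Lagrange's identity, lengths and dot products determine the square; convexity makes the
  -- cross product the positive root.
  cross-consecutive : ∀ i j → cross (e i) (e (suc i)) ≈ cross (e j) (e (suc j))
  cross-consecutive i j = pos-square-injective (cross-consecutive-pos i) (cross-consecutive-pos j)
    (begin-equality
      c i * c i                                  ≈⟨ lemma i ⟩
      ℓ i * ℓ (suc i) - d i * d i                ≈⟨ +-cong (*-cong (equilateral i j) (equilateral (suc i) (suc j)))
                                                      (-‿cong (*-cong (equiangular i j) (equiangular i j))) ⟩
      ℓ j * ℓ (suc j) - d j * d j                ≈⟨ lemma j ⟨
      c j * c j                                  ∎)
    where
    c d ℓ : ℕ → Carrier
    c i = cross (e i) (e (suc i))
    d i = dot (e i) (e (suc i))
    ℓ i = dot (e i) (e i)
    lemma : ∀ i → c i * c i ≈ ℓ i * ℓ (suc i) - d i * d i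
    lemma i = begin-equality
      c i * c i                          ≈⟨ solve 2 (λ x y → y := x :+ y :- x) refl (d i * d i) (c i * c i) ⟩
      d i * d i + c i * c i - d i * d i  ≈⟨ +-congʳ (lagrange (e i) (e (suc i))) ⟨
      ℓ i * ℓ (suc i) - d i * d i        ∎

  -- One and the same rotation, scaled by ℓ, carries every edge to the next.
  cross-shift : ∀ i j → cross (e (suc i)) (e (suc j)) ≈ cross (e i) (e j)
  cross-shift i j = *-cancelˡ ℓℓ-pos (begin-equality
    ℓ * ℓ * cross (e (suc i)) (e (suc j))                        ≈⟨ cross-*ₚ ℓ (e (suc i)) (e (suc j)) ⟨
    cross (ℓ *ₚ e (suc i)) (ℓ *ₚ e (suc j))                      ≈⟨ cross-cong (rotation i) (rotation j) ⟩
    cross (rotate d c (e i)) (rotate d c (e j))                  ≈⟨ cross-rotate d c (e i) (e j) ⟩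
    (d * d + c * c) * cross (e i) (e j)                          ≈⟨ *-congʳ ℓℓ≈ ⟨
    ℓ * ℓ * cross (e i) (e j)                                    ∎)
    where
    ℓ = dot (e 0) (e 0)
    d = dot (e 0) (e 1)
    c = cross (e 0) (e 1)
    rotation : ∀ i → ℓ *ₚ e (suc i) ≈ₚ rotate d c (e i)
    rotation i = ≈ₚ-trans (*-congʳ (equilateral 0 i) , *-congʳ (equilateral 0 i))
      (≈ₚ-trans (rotate-dot-cross (e i) (e (suc i)))
                (rotate-cong (e i) (equiangular i 0) (cross-consecutive i 0)))
    ℓℓ≈ : ℓ * ℓ ≈ d * d + c * c
    ℓℓ≈ = trans (*-congˡ (equilateral 0 1)) (lagrange (e 0) (e 1))
    ℓℓ-pos : 0# < ℓ * ℓ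
    ℓℓ-pos = <-respʳ (trans (+-comm _ _) (sym ℓℓ≈))
      (+-pos-nonNeg (*-pos (cross-consecutive-pos 0) (cross-consecutive-pos 0)) (x²-nonNeg d))

  -- Up to a common positive factor, S s is the sine of s exterior angles.
  S : ℕ → Carrier
  S s = cross (e 0) (e s)

  cross-edges : ∀ s i → cross (e i) (e (s ℕ.+ i)) ≈ S s
  cross-edges s zero    = reflexive (≡.cong (λ u → cross (e 0) (e u)) (ℕ.+-identityʳ s))
  cross-edges s (suc i) = begin-equality
    cross (e (suc i)) (e (s ℕ.+ suc i))   ≡⟨ ≡.cong (λ u → cross (e (suc i)) (e u)) (ℕ.+-suc s i) ⟩
    cross (e (suc i)) (e (suc (s ℕ.+ i))) ≈⟨ cross-shift i (s ℕ.+ i) ⟩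
    cross (e i) (e (s ℕ.+ i))             ≈⟨ cross-edges s i ⟩
    S s                                   ∎

  -- H u is the height of vertex u + i above the line through edge i, scaled by the edge length.
  H : ℕ → Carrier
  H zero    = 0#
  H (suc u) = H u + S u

  height : ∀ i u → cross (e i) (V (u ℕ.+ i) -ₚ V i) ≈ H u
  height i zero    = cross-0ʳ (e i) (V i)
  height i (suc u) = begin-equality
    cross (e i) (V (suc u ℕ.+ i) -ₚ V i)                            ≈⟨ cross-splitʳ (e i) (V i) (V (u ℕ.+ i)) _ ⟩
    cross (e i) (V (u ℕ.+ i) -ₚ V i) + cross (e i) (e (u ℕ.+ i))    ≈⟨ +-cong (height i u) (cross-edges u i) ⟩
    H u + S u                                                       ∎

  S-0 : S 0 ≈ 0#
  S-0 = cross-self (e 0)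

  H-1 : H 1 ≈ 0#
  H-1 = trans (+-identityˡ _) S-0

  H-pos : ∀ u → 2 ℕ.≤ u → u ℕ.< k → 0# < H u
  H-pos u 2≤u u<k = <-respʳ (height 0 u) (convex 0 u 2≤u u<k)

  H-nonNeg : ∀ u → u ℕ.< k → 0# ≤ H u
  H-nonNeg 0               _   = ≤-refl
  H-nonNeg 1               _   = ≤-reflexive (sym H-1)
  H-nonNeg u@(suc (suc _)) u<k = proj₁ (H-pos u (ℕ.s≤s (ℕ.s≤s ℕ.z≤n)) u<k)

  -- The mirror image of `height`: expanding the chord into edges gives S d + ... + S 1, the sum
  -- behind `H (suc d)` read backwards.
  cross-chord-edge : ∀ d b → cross (V (d ℕ.+ b) -ₚ V b) (e (d ℕ.+ b)) ≈ H (suc d)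
  cross-chord-edge zero    b = begin-equality
    cross (V b -ₚ V b) (e b)      ≈⟨ cross-swap _ _ ⟩
    - cross (e b) (V b -ₚ V b)    ≈⟨ -‿cong (cross-0ʳ (e b) (V b)) ⟩
    - 0#                          ≈⟨ Solver.-0≈0 ⟩
    0#                            ≈⟨ H-1 ⟨
    H 1                           ∎
  cross-chord-edge (suc d) b = begin-equality
    cross (V (suc d ℕ.+ b) -ₚ V b) c                ≈⟨ cross-splitˡ c (V b) (V (suc b)) _ ⟩
    cross (e b) c + cross (V (suc d ℕ.+ b) -ₚ V (suc b)) c
      ≈⟨ +-cong (cross-edges (suc d) b) (trans
           (reflexive (≡.cong (λ u → cross (V u -ₚ V (suc b)) (e u)) (≡.sym (ℕ.+-suc d b))))
           (cross-chord-edge d (suc b))) ⟩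
    S (suc d) + H (suc d)                           ≈⟨ +-comm _ _ ⟩
    H (suc (suc d))                                 ∎
    where c = e (suc d ℕ.+ b)

  -- The chord spans 2r + 1 edges, and both of its ends have height `H (suc r)` over the middle one.
  chord∥middle-edge : ∀ r b → cross (e (r ℕ.+ b)) (V (suc r ℕ.+ (r ℕ.+ b)) -ₚ V b) ≈ 0#
  chord∥middle-edge r b = begin-equality
    cross (e q) (V (suc r ℕ.+ q) -ₚ V b)                                ≈⟨ cross-splitʳ (e q) (V b) (V q) _ ⟩
    cross (e q) (V q -ₚ V b) + cross (e q) (V (suc r ℕ.+ q) -ₚ V q)     ≈⟨ +-cong
      (trans (cross-swap _ _) (-‿cong (cross-chord-edge r b))) (height q (suc r)) ⟩
    - H (suc r) + H (suc r)                                             ≈⟨ -‿inverseˡ _ ⟩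
    0#                                                                  ∎
    where q = r ℕ.+ b

  -- The Plücker relation for edges 0 and 1, a chord `y` from vertex 1 spanning 2r + 1 edges, and
  -- its middle edge `z`. The last term vanishes because `y` and `z` are parallel.
  S-H-ratio : ∀ r → H (suc (r ℕ.+ r)) * S (suc r) ≈ S r * H (suc r ℕ.+ suc r)
  S-H-ratio r = begin-equality
    H (suc (r ℕ.+ r)) * S (suc r)                                        ≈⟨ *-cong h₁ s₁ ⟨
    cross (e 1) y * cross (e 0) z                                        ≈⟨ plücker (e 0) (e 1) y z ⟩
    cross (e 1) z * cross (e 0) y + cross (e 0) (e 1) * cross z y        ≈⟨ +-cong (*-cong (cross-edges r 1) h₀)
                                                                              (*-congˡ (chord∥middle-edge r 1)) ⟩
    S r * H (suc r ℕ.+ suc r) + cross (e 0) (e 1) * 0#                   ≈⟨ +-congˡ (zeroʳ _) ⟩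
    S r * H (suc r ℕ.+ suc r) + 0#                                       ≈⟨ +-identityʳ _ ⟩
    S r * H (suc r ℕ.+ suc r)                                            ∎
    where
    z = e (r ℕ.+ 1)
    y = V (suc r ℕ.+ (r ℕ.+ 1)) -ₚ V 1
    s₁ : cross (e 0) z ≈ S (suc r)
    s₁ = reflexive (≡.cong S (ℕ.+-comm r 1))
    h₁ : cross (e 1) y ≈ H (suc (r ℕ.+ r))
    h₁ = trans (reflexive (≡.cong (λ u → cross (e 1) (V u -ₚ V 1)) (≡.sym (ℕ.+-assoc (suc r) r 1))))
               (height 1 (suc r ℕ.+ r))
    h₀ : cross (e 0) y ≈ H (suc r ℕ.+ suc r)
    h₀ = begin-equality
      cross (e 0) y                      ≈⟨ +-identityˡ _ ⟨
      0# + cross (e 0) y                 ≈⟨ +-congʳ (cross-self (e 0)) ⟨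
      cross (e 0) (e 0) + cross (e 0) y  ≈⟨ cross-splitʳ (e 0) (V 0) (V 1) _ ⟨
      cross (e 0) (V (suc r ℕ.+ (r ℕ.+ 1)) -ₚ V 0)   ≡⟨ ≡.cong (λ u → cross (e 0) (V u -ₚ V 0)) (index r) ⟩
      cross (e 0) (V (suc r ℕ.+ suc r ℕ.+ 0) -ₚ V 0)  ≈⟨ height 0 (suc r ℕ.+ suc r) ⟩
      H (suc r ℕ.+ suc r)                ∎
      where
      index : ∀ r → suc r ℕ.+ (r ℕ.+ 1) ≡ suc r ℕ.+ suc r ℕ.+ 0
      index r = ≡.trans (≡.cong (suc r ℕ.+_) (ℕ.+-comm r 1)) (≡.sym (ℕ.+-identityʳ _))

  -- The bound keeps the vertices of both heights in `S-H-ratio` off edge 0, so the heights are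
  -- positive and the sign of `S` passes from each index to the next.
  S-pos : ∀ s → suc s ℕ.+ suc s ℕ.< k → 0# < S (suc s)
  S-pos zero    _  = cross-consecutive-pos 0
  S-pos (suc s) lt = pos-factor (H-pos (suc (r ℕ.+ r)) (ℕ.s≤s (ℕ.s≤s ℕ.z≤n)) (ℕ.<-trans (ℕ.s≤s (ℕ.+-monoʳ-< r (ℕ.n<1+n r))) lt))
    (<-respʳ (sym (S-H-ratio r)) (*-pos (S-pos s (ℕ.<-trans (ℕ.+-mono-< (ℕ.n<1+n r) (ℕ.n<1+n r)) lt))
      (H-pos (suc r ℕ.+ suc r) (ℕ.s≤s (ℕ.s≤s ℕ.z≤n)) lt)))
    where r = suc s

  -- The sine of a full turn minus an angle: by periodicity edge `s′ + s` is edge 0 again, and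
  -- exchanging the arguments of `cross` changes the sign.
  S-reflect : ∀ s s′ → s′ ℕ.+ s ≡ k → S s′ ≈ - S s
  S-reflect s s′ eq = begin-equality
    S s′                            ≈⟨ cross-edges s′ s ⟨
    cross (e s) (e (s′ ℕ.+ s))      ≡⟨ ≡.cong (λ u → cross (e s) (V (suc u) -ₚ V u)) (≡.trans eq (≡.sym (ℕ.+-identityʳ k))) ⟩
    cross (e s) (V (suc (k ℕ.+ 0)) -ₚ V (k ℕ.+ 0))
      ≡⟨ ≡.cong₂ (λ p q → cross (e s) (p -ₚ q)) (≡.trans (≡.cong V (≡.sym (ℕ.+-suc k 0))) (periodic 1)) (periodic 0) ⟩
    cross (e s) (e 0)               ≈⟨ cross-swap (e s) (e 0) ⟩
    - S s                           ∎

  S-half : ∀ s → s ℕ.+ s ≡ k → S s ≈ 0#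
  S-half s eq = *-cancelˡ-0 (0<⇒≉0 (+-pos-nonNeg 0<1 0≤1)) (begin-equality
    (1# + 1#) * S s   ≈⟨ solve 1 (λ s → (con (+ 1) :+ con (+ 1)) :* s := s :+ s) refl (S s) ⟩
    S s + S s         ≈⟨ +-congˡ (S-reflect s s eq) ⟩
    S s - S s         ≈⟨ -‿inverseʳ _ ⟩
    0#                ∎)

  S-nonNeg : ∀ s → s ℕ.+ s ℕ.≤ k → 0# ≤ S s
  S-nonNeg zero    _  = ≤-reflexive (sym S-0)
  S-nonNeg (suc s) le with ℕ.m≤n⇒m<n∨m≡n le
  ... | inj₁ lt = proj₁ (S-pos s lt)
  ... | inj₂ eq = ≤-reflexive (sym (S-half (suc s) eq))

  S-nonPos : ∀ s → s ℕ.≤ k → k ℕ.≤ s ℕ.+ s → S s ≤ 0#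
  S-nonPos s s≤k k≤2s = 0≤y-x⇒x≤y (≤-respʳ-≈ (begin-equality
      S s′       ≈⟨ S-reflect s s′ (ℕ.m∸n+n≡m s≤k) ⟩
      - S s      ≈⟨ +-identityˡ _ ⟨
      0# - S s   ∎)
    (S-nonNeg s′ (ℕ.≤-trans (ℕ.+-monoʳ-≤ s′ s′≤s) (ℕ.≤-reflexive (ℕ.m∸n+n≡m s≤k)))))
    where
    s′ = k ℕ.∸ s
    s′≤s : s′ ℕ.≤ s
    s′≤s = ℕ.m≤n+o⇒m∸n≤o k s k≤2s

  module _ (m : ℕ) (2m≤k : m ℕ.+ m ℕ.≤ k) (k≤2m+1 : k ℕ.≤ suc (m ℕ.+ m)) where

    H-increases : ∀ t {u} → t ℕ.+ u ℕ.≤ suc m → H u ≤ H (t ℕ.+ u)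
    H-increases zero    _  = ≤-refl
    H-increases (suc t) {u} (ℕ.s≤s le) = ≤-trans (H-increases t {u} (ℕ.m≤n⇒m≤1+n le))
      (≤-by (S-nonNeg (t ℕ.+ u) (ℕ.≤-trans (ℕ.+-mono-≤ le le) 2m≤k)) refl)

    H-decreases : ∀ t → t ℕ.+ suc m ℕ.≤ k → H (t ℕ.+ suc m) ≤ H (suc m)
    H-decreases zero    _  = ≤-refl
    H-decreases (suc t) le = ≤-trans
      (≤-by (x≤0⇒0≤-x (S-nonPos u (ℕ.<⇒≤ le) (ℕ.≤-trans k≤2m+1
               (ℕ.+-mono-≤ {suc m} (ℕ.m≤n+m (suc m) t) (ℕ.≤-trans (ℕ.n≤1+n m) (ℕ.m≤n+m (suc m) t))))))
            (solve 2 (λ h s → h := h :+ s :+ :- s) refl (H u) (S u)))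
      (H-decreases t (ℕ.<⇒≤ le))
      where u = t ℕ.+ suc m

    -- The increments `S` of the heights are nonnegative up to index `m` and nonpositive beyond it,
    -- so the heights have a single peak, at `suc m`.
    H-max : ∀ u → u ℕ.≤ k → H u ≤ H (suc m)
    H-max u u≤k with ℕ.≤-total u (suc m)
    ... | inj₁ u≤ = ≡.subst (λ t → H u ≤ H t) (ℕ.m∸n+n≡m u≤) (H-increases (suc m ℕ.∸ u) (ℕ.≤-reflexive (ℕ.m∸n+n≡m u≤)))
    ... | inj₂ u≥ = ≡.subst (λ t → H t ≤ H (suc m)) (ℕ.m∸n+n≡m u≥) (H-decreases (u ℕ.∸ suc m) (ℕ.≤-trans (ℕ.≤-reflexive (ℕ.m∸n+n≡m u≥)) u≤k))

  -- The chord w and the longer chord a + w + c joining the outer neighbours of its ends are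
  -- the parallel sides of an isosceles trapezoid.
  trapezoid : ∀ d i → (H (suc d) + S (suc d)) *ₚ (V (suc d ℕ.+ i) -ₚ V (suc i))
                      ≈ₚ H (suc d) *ₚ (V (suc (suc d ℕ.+ i)) -ₚ V i)
  trapezoid d i = component proj₁ (proj₁ base) , component proj₂ (proj₂ base)
    where
    a = e i
    c = e (suc d ℕ.+ i)
    w = V (suc d ℕ.+ i) -ₚ V (suc i)
    h = H (suc d)
    s = S (suc d)
    a×w : cross a w ≈ h
    a×w = begin-equality
      cross a w                                    ≈⟨ +-identityˡ _ ⟨
      0# + cross a w                               ≈⟨ +-congʳ (cross-self a) ⟨
      cross a a + cross a w                        ≈⟨ cross-splitʳ a (V i) (V (suc i)) _ ⟨
      cross a (V (suc d ℕ.+ i) -ₚ V i)             ≈⟨ height i (suc d) ⟩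
      h                                            ∎
    w×c : cross w c ≈ h
    w×c = trans (reflexive (≡.cong (λ u → cross (V u -ₚ V (suc i)) (e u)) (≡.sym (ℕ.+-suc d i))))
                (cross-chord-edge d (suc i))
    base : s *ₚ w ≈ₚ h *ₚ a +ₚ h *ₚ c
    -- Cramer's rule expands `w` in the two legs `a` and `c`; the equal coefficients `h` express the
    -- symmetry of the trapezoid. Adding `h *ₚ w` to both sides gives the claim.
    base = ≈ₚ-trans (*-congʳ (sym s≈) , *-congʳ (sym s≈))
      (≈ₚ-trans (cramer a c w) (+-cong (*-congʳ w×c) (*-congʳ a×w) , +-cong (*-congʳ w×c) (*-congʳ a×w)))
      where
      s≈ : cross a c ≈ s
      s≈ = cross-edges (suc d) i
    component : (f : Point → Carrier) → s * (f (V (suc d ℕ.+ i)) - f (V (suc i)))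
                  ≈ h * (f (V (suc i)) - f (V i)) + h * (f (V (suc (suc d ℕ.+ i))) - f (V (suc d ℕ.+ i))) →
                (h + s) * (f (V (suc d ℕ.+ i)) - f (V (suc i))) ≈ h * (f (V (suc (suc d ℕ.+ i))) - f (V i))
    component f eq = begin-equality
      (h + s) * (y - x)                 ≈⟨ distribʳ _ _ _ ⟩
      h * (y - x) + s * (y - x)         ≈⟨ +-congˡ eq ⟩
      h * (y - x) + (h * (x - o) + h * (z - y))  ≈⟨ solve 5 (λ h o x y z →
          h :* (y :- x) :+ (h :* (x :- o) :+ h :* (z :- y)) := h :* (z :- o)) refl h o x y z ⟩
      h * (z - o)                       ∎
      where
      o = f (V i)
      x = f (V (suc i))
      y = f (V (suc d ℕ.+ i))
      z = f (V (suc (suc d ℕ.+ i)))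

-- Convex hulls and linear bounds on them

module ConvexHull (ℝ : CompleteOrderedField) where
  open CompleteOrderedField ℝ hiding (zero)
  open OrderedField ℝ
  open Plane ℝ
  open CrossProduct ℝ
  open Solver using (solve; con; _:=_; _:+_; _:*_; :-_; _:-_)
  open MonoidSum +-commutativeMonoid using (sum; sum-cong-≋)
  open ≤-Reasoning

  sum-linear : ∀ {n} a b c (f g h : Fin n → Carrier) →
    sum (λ i → a * f i + b * g i + c * h i) ≈ a * sum f + b * sum g + c * sum h
  sum-linear {zero}  a b c f g h = solve 3 (λ a b c →
    con (+ 0) := a :* con (+ 0) :+ b :* con (+ 0) :+ c :* con (+ 0)) refl a b c
  sum-linear {suc n} a b c f g h = trans (+-congˡ (sum-linear a b c (f ∘ suc) (g ∘ suc) (h ∘ suc)))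
    (solve 9 (λ a b c f g h f′ g′ h′ →
      a :* f :+ b :* g :+ c :* h :+ (a :* f′ :+ b :* g′ :+ c :* h′)
        := a :* (f :+ f′) :+ b :* (g :+ g′) :+ c :* (h :+ h′)) refl
      a b c (f zero) (g zero) (h zero) (sum (f ∘ suc)) (sum (g ∘ suc)) (sum (h ∘ suc)))

  sum-mono-≤ : ∀ {n} {f g : Fin n → Carrier} → (∀ i → f i ≤ g i) → sum f ≤ sum g
  sum-mono-≤ {zero}  f≤g = ≤-refl
  sum-mono-≤ {suc n} f≤g = +-mono-≤ (f≤g zero) (sum-mono-≤ (f≤g ∘ suc))

  sum-0 : ∀ {n} (f : Fin n → Carrier) → sum (λ i → 0# * f i) ≈ 0#
  sum-0 {zero}  f = refl
  sum-0 {suc n} f = trans (+-cong (zeroˡ _) (sum-0 (f ∘ suc))) (+-identityʳ 0#)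

  δ : ∀ {n} → Fin n → Fin n → Carrier
  δ zero    zero    = 1#
  δ zero    (suc j) = 0#
  δ (suc i) zero    = 0#
  δ (suc i) (suc j) = δ i j

  δ-nonNeg : ∀ {n} (i j : Fin n) → 0# ≤ δ i j
  δ-nonNeg zero    zero    = 0≤1
  δ-nonNeg zero    (suc j) = ≤-refl
  δ-nonNeg (suc i) zero    = ≤-refl
  δ-nonNeg (suc i) (suc j) = δ-nonNeg i j

  sum-δ : ∀ {n} (i : Fin n) (f : Fin n → Carrier) → sum (λ j → δ i j * f j) ≈ f i
  sum-δ zero    f = trans (+-cong (*-identityˡ _) (sum-0 (f ∘ suc))) (+-identityʳ _)
  sum-δ (suc i) f = trans (+-cong (zeroˡ _) (sum-δ i (f ∘ suc))) (+-identityˡ _)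

  -- Three points rather than two: when two weights sum to at most one, a third point has to carry
  -- the remaining weight.
  Convex : Pred Point 0ℓ → Set
  Convex P = ∀ {a b c p q r x} → 0# ≤ a → 0# ≤ b → 0# ≤ c → a + b + c ≈ 1# →
    p ∈ P → q ∈ P → r ∈ P → x ≈ₚ a *ₚ p +ₚ b *ₚ q +ₚ c *ₚ r → x ∈ P

  -- The interface through which the geometry uses P; convex weights do not appear after this.
  -- `P-bounds` transfers a strip containing all vertices to all of P.
  record IsHull (P : Pred Point 0ℓ) (V : ℕ → Point) : Set where
    field
      V∈P      : ∀ i → V i ∈ P
      P-convex : Convex P
      P-bounds : ∀ {a o t} → (∀ i → 0# ≤ cross a (V i -ₚ o)) → (∀ i → cross a (V i -ₚ o) ≤ t) →
                 ∀ {p} → p ∈ P → 0# ≤ cross a (p -ₚ o) × cross a (p -ₚ o) ≤ t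

  module _ {k} (v : Fin k → Point) where

    vertex∈hull : ∀ i → v i ∈ convexHull v
    vertex∈hull i = δ i , δ-nonNeg i
      , trans (sum-cong-≋ (λ j → sym (*-identityʳ (δ i j)))) (sum-δ i (λ _ → 1#))
      , sym (sum-δ i (proj₁ ∘ v)) , sym (sum-δ i (proj₂ ∘ v))

    hull-convex : Convex (convexHull v)
    hull-convex {a} {b} {c} {p} {q} {r} {x} 0≤a 0≤b 0≤c a+b+c≈1
      (f , 0≤f , ∑f≈1 , p₁≈ , p₂≈) (g , 0≤g , ∑g≈1 , q₁≈ , q₂≈) (h , 0≤h , ∑h≈1 , r₁≈ , r₂≈) (x₁≈ , x₂≈) =
        (λ i → a * f i + b * g i + c * h i)
      , (λ i → +-nonNeg (+-nonNeg (*-nonNeg 0≤a (0≤f i)) (*-nonNeg 0≤b (0≤g i))) (*-nonNeg 0≤c (0≤h i)))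
      , trans (sum-linear a b c f g h) (trans (+-cong (+-cong (*-congˡ ∑f≈1) (*-congˡ ∑g≈1)) (*-congˡ ∑h≈1))
          (trans (+-cong (+-cong (*-identityʳ a) (*-identityʳ b)) (*-identityʳ c)) a+b+c≈1))
      , coordinate (proj₁ ∘ v) p₁≈ q₁≈ r₁≈ x₁≈ , coordinate (proj₂ ∘ v) p₂≈ q₂≈ r₂≈ x₂≈
      where
      coordinate : ∀ {p q r x} (y : Fin k → Carrier) → p ≈ sum (λ i → f i * y i) → q ≈ sum (λ i → g i * y i) →
        r ≈ sum (λ i → h i * y i) → x ≈ a * p + b * q + c * r →
        x ≈ sum (λ i → (a * f i + b * g i + c * h i) * y i)
      coordinate {p} {q} {r} {x} y p≈ q≈ r≈ x≈ = begin-equality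
        x
          ≈⟨ x≈ ⟩
        a * p + b * q + c * r
          ≈⟨ +-cong (+-cong (*-congˡ p≈) (*-congˡ q≈)) (*-congˡ r≈) ⟩
        a * sum (λ i → f i * y i) + b * sum (λ i → g i * y i) + c * sum (λ i → h i * y i)
          ≈⟨ sum-linear a b c (λ i → f i * y i) (λ i → g i * y i) (λ i → h i * y i) ⟨
        sum (λ i → a * (f i * y i) + b * (g i * y i) + c * (h i * y i))
          ≈⟨ sum-cong-≋ (λ i → solve 7 (λ a b c f g h y → a :* (f :* y) :+ b :* (g :* y) :+ c :* (h :* y)
               := (a :* f :+ b :* g :+ c :* h) :* y) refl a b c (f i) (g i) (h i) (y i)) ⟩
        sum (λ i → (a * f i + b * g i + c * h i) * y i) ∎

    hull-cross-bounds : ∀ {a o t} → (∀ i → 0# ≤ cross a (v i -ₚ o)) → (∀ i → cross a (v i -ₚ o) ≤ t) →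
      ∀ {p} → p ∈ convexHull v → 0# ≤ cross a (p -ₚ o) × cross a (p -ₚ o) ≤ t
    hull-cross-bounds {a₁ , a₂} {o₁ , o₂} {t} lower upper {x , y} (w , 0≤w , ∑w≈1 , x≈ , y≈) =
        (begin
          0#                                ≈⟨ sum-0 w ⟨
          sum (λ i → 0# * w i)              ≤⟨ sum-mono-≤ (λ i → ≤-respˡ-≈ (sym (zeroˡ _)) (*-nonNeg (0≤w i) (lower i))) ⟩
          sum (λ i → w i * f i)             ≈⟨ value ⟨
          cross a ((x , y) -ₚ o)            ∎)
      , (begin
          cross a ((x , y) -ₚ o)                       ≈⟨ value ⟩
          sum (λ i → w i * f i)                        ≤⟨ sum-mono-≤ (λ i → *-monoˡ-≤ (0≤w i) (upper i)) ⟩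
          sum (λ i → w i * t)                          ≈⟨ sum-cong-≋ (λ i → solve 2 (λ w t →
                                                           w :* t := t :* w :+ con (+ 0) :* w :+ con (+ 0) :* w) refl (w i) t) ⟩
          sum (λ i → t * w i + 0# * w i + 0# * w i)    ≈⟨ sum-linear t 0# 0# w w w ⟩
          t * sum w + 0# * sum w + 0# * sum w          ≈⟨ solve 2 (λ s t →
                                                           t :* s :+ con (+ 0) :* s :+ con (+ 0) :* s := t :* s) refl (sum w) t ⟩
          t * sum w                                    ≈⟨ *-congˡ ∑w≈1 ⟩
          t * 1#                                       ≈⟨ *-identityʳ t ⟩
          t                                            ∎)
      where
      a = a₁ , a₂
      o = o₁ , o₂
      f = λ i → cross a (v i -ₚ o)
      -- The constant term of the affine function `cross a (p -ₚ o)` of `p`; it moves into the sum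
      -- because the weights add up to one.
      κ = a₂ * o₁ - a₁ * o₂
      ∑x = sum (λ i → w i * proj₁ (v i))
      ∑y = sum (λ i → w i * proj₂ (v i))
      value : cross a ((x , y) -ₚ o) ≈ sum (λ i → w i * f i)
      value = begin-equality
        a₁ * (y - o₂) - a₂ * (x - o₁)                   ≈⟨ +-cong (*-congˡ (+-congʳ y≈)) (-‿cong (*-congˡ (+-congʳ x≈))) ⟩
        a₁ * (∑y - o₂) - a₂ * (∑x - o₁)                 ≈⟨ solve 7 (λ a₁ a₂ o₁ o₂ x y u →
            a₁ :* (y :- o₂) :- a₂ :* (x :- o₁)
              := a₁ :* y :+ :- a₂ :* x :+ (a₂ :* o₁ :- a₁ :* o₂) :* con (+ 1)) refl a₁ a₂ o₁ o₂ ∑x ∑y 1# ⟩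
        a₁ * ∑y + - a₂ * ∑x + κ * 1#                    ≈⟨ +-congˡ (*-congˡ ∑w≈1) ⟨
        a₁ * ∑y + - a₂ * ∑x + κ * sum w                 ≈⟨ sum-linear a₁ (- a₂) κ (λ i → w i * proj₂ (v i)) (λ i → w i * proj₁ (v i)) w ⟨
        sum (λ i → a₁ * (w i * proj₂ (v i)) + - a₂ * (w i * proj₁ (v i)) + κ * w i)
          ≈⟨ sum-cong-≋ (λ i → solve 7 (λ a₁ a₂ o₁ o₂ w x y →
               a₁ :* (w :* y) :+ :- a₂ :* (w :* x) :+ (a₂ :* o₁ :- a₁ :* o₂) :* w
                 := w :* (a₁ :* (y :- o₂) :- a₂ :* (x :- o₁))) refl a₁ a₂ o₁ o₂ (w i) (proj₁ (v i)) (proj₂ (v i))) ⟩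
        sum (λ i → w i * f i)                           ∎

-- The difference body and its interior

module DifferenceBody (ℝ : CompleteOrderedField) {P : Pred (Plane.Point ℝ) 0ℓ}
  (P-convex : ConvexHull.Convex ℝ P) where
  open CompleteOrderedField ℝ
  open Plane ℝ
  open OrderedField ℝ
  open CrossProduct ℝ
  open Solver using (solve; con; _:=_; _:+_; _:*_; :-_; _:-_)
  open ≤-Reasoning

  2# : Carrier
  2# = 1# + 1#

  0<2 : 0# < 2#
  0<2 = +-pos-nonNeg 0<1 0≤1

  infix 8 -ₚ_
  -ₚ_ : Point → Point
  -ₚ (x , y) = - x , - y

  -- The difference bodies of P and of 2P. Membership in `E` of the difference of two centres is the
  -- intersection test for copies of 2P.
  D E : Pred Point 0ℓ
  D x = ∃[ p ] ∃[ q ] p ∈ P × q ∈ P × x ≈ₚ p -ₚ q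
  E x = ∃[ p ] ∃[ q ] p ∈ P × q ∈ P × x ≈ₚ 2# *ₚ p -ₚ 2# *ₚ q

  D-difference : ∀ {p q} → p ∈ P → q ∈ P → p -ₚ q ∈ D
  D-difference p∈P q∈P = _ , _ , p∈P , q∈P , ≈ₚ-refl

  D-resp : ∀ {x y} → x ≈ₚ y → x ∈ D → y ∈ D
  D-resp x≈y (p , q , p∈P , q∈P , eq) = p , q , p∈P , q∈P , ≈ₚ-trans (≈ₚ-sym x≈y) eq

  -‿flip : ∀ {x p q} → x ≈ p - q → - x ≈ q - p
  -‿flip {x} {p} {q} eq = trans (-‿cong eq) (solve 2 (λ p q → :- (p :- q) := q :- p) refl p q)

  D-neg : ∀ {x} → x ∈ D → -ₚ x ∈ D
  D-neg (p , q , p∈P , q∈P , eq₁ , eq₂) = q , p , q∈P , p∈P , -‿flip eq₁ , -‿flip eq₂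

  E-neg : ∀ {x} → x ∈ E → -ₚ x ∈ E
  E-neg (p , q , p∈P , q∈P , eq₁ , eq₂) = q , p , q∈P , p∈P , -‿flip eq₁ , -‿flip eq₂

  E-resp : ∀ {x y} → x ≈ₚ y → x ∈ E → y ∈ E
  E-resp x≈y (p , q , p∈P , q∈P , eq) = p , q , p∈P , q∈P , ≈ₚ-trans (≈ₚ-sym x≈y) eq

  -- The remaining weight `c` is put on one and the same point of P in the minuend and the
  -- subtrahend, where it cancels.
  D-combine : ∀ {a b x y} → 0# ≤ a → 0# ≤ b → a + b ≤ 1# → x ∈ D → y ∈ D → a *ₚ x +ₚ b *ₚ y ∈ D
  D-combine {a} {b} 0≤a 0≤b a+b≤1 (p , q , p∈P , q∈P , x₁≈ , x₂≈) (r , s , r∈P , s∈P , y₁≈ , y₂≈) =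
      _ , _ , combine p∈P r∈P p∈P ≈ₚ-refl , combine q∈P s∈P p∈P ≈ₚ-refl
    , coordinate x₁≈ y₁≈ , coordinate x₂≈ y₂≈
    where
    c = 1# - (a + b)
    combine : ∀ {p q r x} → p ∈ P → q ∈ P → r ∈ P → x ≈ₚ a *ₚ p +ₚ b *ₚ q +ₚ c *ₚ r → x ∈ P
    combine = P-convex 0≤a 0≤b (x≤y⇒0≤y-x a+b≤1)
      (solve 2 (λ a b → a :+ b :+ (con (+ 1) :- (a :+ b)) := con (+ 1)) refl a b)
    coordinate : ∀ {x y p q r s o} → x ≈ p - q → y ≈ r - s →
      a * x + b * y ≈ (a * p + b * r + c * o) - (a * q + b * s + c * o)
    coordinate {p = p} {q} {r} {s} {o} x≈ y≈ = trans (+-cong (*-congˡ x≈) (*-congˡ y≈))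
      (solve 8 (λ a b c p q r s o → a :* (p :- q) :+ b :* (r :- s)
        := (a :* p :+ b :* r :+ c :* o) :- (a :* q :+ b :* s :+ c :* o)) refl a b c p q r s o)

  D-scale : ∀ {a x} → 0# ≤ a → a ≤ 1# → x ∈ D → a *ₚ x ∈ D
  D-scale {a} {x} 0≤a a≤1 x∈D = D-resp (eq , eq)
    (D-combine 0≤a ≤-refl (≤-respˡ-≈ (sym (+-identityʳ a)) a≤1) x∈D x∈D)
    where
    eq : ∀ {x} → a * x + 0# * x ≈ a * x
    eq = trans (+-congˡ (zeroˡ _)) (+-identityʳ _)

  -- By convexity the sum of two points of P is twice their midpoint, hence a point of 2P.
  D+D⊆E : ∀ {x y} → x ∈ D → y ∈ D → x +ₚ y ∈ E
  D+D⊆E (p , q , p∈P , q∈P , x₁≈ , x₂≈) (r , s , r∈P , s∈P , y₁≈ , y₂≈) with pos-inverse 0<2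
  ... | ½ , 0<½ , 2½≈1 = _ , _ , average p∈P r∈P ≈ₚ-refl , average q∈P s∈P ≈ₚ-refl
    , coordinate x₁≈ y₁≈ , coordinate x₂≈ y₂≈
    where
    average : ∀ {p q x} → p ∈ P → q ∈ P → x ≈ₚ ½ *ₚ p +ₚ ½ *ₚ q +ₚ 0# *ₚ p → x ∈ P
    average p∈P q∈P = P-convex (proj₁ 0<½) (proj₁ 0<½) ≤-refl
      (trans (solve 1 (λ h → h :+ h :+ con (+ 0) := (con (+ 1) :+ con (+ 1)) :* h) refl ½) 2½≈1) p∈P q∈P p∈P
    double : ∀ p q → 2# * (½ * p + ½ * q + 0# * p) ≈ p + q
    double p q = begin-equality
      2# * (½ * p + ½ * q + 0# * p)   ≈⟨ solve 4 (λ t h p q → t :* (h :* p :+ h :* q :+ con (+ 0) :* p)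
                                           := t :* h :* (p :+ q)) refl 2# ½ p q ⟩
      2# * ½ * (p + q)                ≈⟨ *-congʳ 2½≈1 ⟩
      1# * (p + q)                    ≈⟨ *-identityˡ _ ⟩
      p + q                           ∎
    coordinate : ∀ {x y p q r s} → x ≈ p - q → y ≈ r - s →
      x + y ≈ 2# * (½ * p + ½ * r + 0# * p) - 2# * (½ * q + ½ * s + 0# * q)
    coordinate {x} {y} {p} {q} {r} {s} x≈ y≈ = begin-equality
      x + y               ≈⟨ +-cong x≈ y≈ ⟩
      (p - q) + (r - s)   ≈⟨ solve 4 (λ p q r s → (p :- q) :+ (r :- s) := (p :+ r) :- (q :+ s)) refl p q r s ⟩
      (p + r) - (q + s)   ≈⟨ +-cong (double p r) (-‿cong (double q s)) ⟨
      2# * (½ * p + ½ * r + 0# * p) - 2# * (½ * q + ½ * s + 0# * q) ∎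

  -- A quantitative interior of `D`: the margin `η` is measured in copies of `D` itself, so no
  -- topology enters.
  Interior : Carrier → Pred Point 0ℓ
  Interior η x = ∀ {y} → y ∈ D → x +ₚ η *ₚ y ∈ D

  interior-neg : ∀ {η x} → x ∈ Interior η → -ₚ x ∈ Interior η
  interior-neg {η} {x} x∈I {y} y∈D = D-resp (eq , eq) (D-neg (x∈I (D-neg y∈D)))
    where
    eq : ∀ {x y} → - (x + η * - y) ≈ - x + η * y
    eq {x} {y} = solve 3 (λ η x y → :- (x :+ η :* :- y) := :- x :+ η :* y) refl η x y

  interior-scale : ∀ {η t x} → 0# ≤ t → t ≤ 1# → x ∈ Interior η → x ∈ Interior (η * t)
  interior-scale {η} {t} {x} 0≤t t≤1 x∈I {y} y∈D = D-resp (eq , eq) (x∈I (D-scale 0≤t t≤1 y∈D))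
    where
    eq : ∀ {x y} → x + η * (t * y) ≈ x + η * t * y
    eq = +-congˡ (sym (*-assoc _ _ _))

  -- `x` is `y` shrunk by h/(h + s). The rest of the weight, s/(h + s), is free for an arbitrary
  -- point of `D` and serves as `η`.
  shrunk-interior : ∀ {h s x y} → 0# ≤ h → 0# < s → (h + s) *ₚ x ≈ₚ h *ₚ y → y ∈ D →
    ∃[ η ] 0# < η × η ≤ 1# × x ∈ Interior η
  shrunk-interior {h} {s} {x} {y} 0≤h 0<s (eq₁ , eq₂) y∈D with pos-inverse (<-respʳ (+-comm s h) (+-pos-nonNeg 0<s 0≤h))
  ... | i , 0<i , [h+s]i≈1 = s * i , *-pos 0<s 0<i , ≤-by (*-nonNeg 0≤h (proj₁ 0<i))
      (trans (sym total≈1) (+-comm _ _))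
    , λ z∈D → D-resp (coordinate eq₁ , coordinate eq₂)
        (D-combine (*-nonNeg 0≤h (proj₁ 0<i)) (proj₁ (*-pos 0<s 0<i)) (≤-reflexive total≈1) y∈D z∈D)
    where
    total≈1 : h * i + s * i ≈ 1#
    total≈1 = trans (sym (distribʳ i h s)) [h+s]i≈1
    coordinate : ∀ {x y z} → (h + s) * x ≈ h * y → h * i * y + s * i * z ≈ x + s * i * z
    coordinate {x} {y} {z} eq = +-congʳ (begin-equality
      h * i * y         ≈⟨ solve 3 (λ h i y → h :* i :* y := i :* (h :* y)) refl h i y ⟩
      i * (h * y)       ≈⟨ *-congˡ eq ⟨
      i * ((h + s) * x) ≈⟨ solve 3 (λ c i x → i :* (c :* x) := c :* i :* x) refl (h + s) i x ⟩
      (h + s) * i * x   ≈⟨ *-congʳ [h+s]i≈1 ⟩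
      1# * x            ≈⟨ *-identityˡ x ⟩
      x                 ∎)

  module _ (η : Carrier) where

    -- Translates of 2P by p and q still intersect after perturbations of size η.
    Overlap : Point → Point → Set
    Overlap p q = ∃[ x ] ∃[ z ] x ∈ Interior η × z ∈ D × p -ₚ q ≈ₚ x +ₚ z

    overlap-swap : ∀ {p q} → Overlap p q → Overlap q p
    overlap-swap (x , z , x∈I , z∈D , eq₁ , eq₂) = -ₚ x , -ₚ z , interior-neg x∈I , D-neg z∈D , coordinate eq₁ , coordinate eq₂
      where
      coordinate : ∀ {p q x z} → p - q ≈ x + z → q - p ≈ - x + - z
      coordinate {p} {q} {x} {z} eq = begin-equality
        q - p       ≈⟨ solve 2 (λ p q → q :- p := :- (p :- q)) refl p q ⟩
        - (p - q)   ≈⟨ -‿cong eq ⟩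
        - (x + z)   ≈⟨ solve 2 (λ x z → :- (x :+ z) := :- x :+ :- z) refl x z ⟩
        - x + - z   ∎

    -- Anchors are sums of two vertices. Pairing these crosswise turns the difference into two
    -- chords, only one of which has to be interior.
    overlap-sums : ∀ {a b c d} → a -ₚ d ∈ Interior η → b -ₚ c ∈ D → Overlap (a +ₚ b) (c +ₚ d)
    overlap-sums {a} {b} {c} {d} x∈I z∈D = _ , _ , x∈I , z∈D , coordinate , coordinate
      where
      coordinate : ∀ {a b c d} → (a + b) - (c + d) ≈ (a - d) + (b - c)
      coordinate {a} {b} {c} {d} =
        solve 4 (λ a b c d → (a :+ b) :- (c :+ d) := (a :- d) :+ (b :- c)) refl a b c d

    -- By symmetry of `D` the total perturbation is `η` times a point of `D`, so the interior
    -- summand absorbs it and both summands stay in `D`.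
    overlap⇒E : ∀ {p q g h s t} → 0# ≤ s → 0# ≤ t → s + t ≤ 1# → g ∈ D → h ∈ D → Overlap p q →
      (p +ₚ (η * s) *ₚ g) -ₚ (q +ₚ (η * t) *ₚ h) ∈ E
    overlap⇒E {p} {q} {g} {h} {s} {t} 0≤s 0≤t s+t≤1 g∈D h∈D (x , z , x∈I , z∈D , eq₁ , eq₂) =
      E-resp (coordinate eq₁ , coordinate eq₂)
        (D+D⊆E (x∈I (D-combine 0≤s 0≤t s+t≤1 g∈D (D-neg h∈D))) z∈D)
      where
      coordinate : ∀ {p q x z g h} → p - q ≈ x + z →
        x + η * (s * g + t * - h) + z ≈ (p + η * s * g) - (q + η * t * h)
      coordinate {p} {q} {x} {z} {g} {h} eq = begin-equality
        x + η * (s * g + t * - h) + z             ≈⟨ solve 7 (λ x z η s t g h → x :+ η :* (s :* g :+ t :* :- h) :+ z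
                                                       := (x :+ z) :+ (η :* s :* g :- η :* t :* h)) refl x z η s t g h ⟩
        (x + z) + (η * s * g - η * t * h)         ≈⟨ +-congʳ eq ⟨
        (p - q) + (η * s * g - η * t * h)         ≈⟨ solve 4 (λ p q g h → (p :- q) :+ (g :- h) := (p :+ g) :- (q :+ h))
                                                       refl p q (η * s * g) (η * t * h) ⟩
        (p + η * s * g) - (q + η * t * h)         ∎

-- Periodic sequences

module _ {A : Set} (k : ℕ) (V : ℕ → A) (periodic : ∀ i → V (k ℕ.+ i) ≡ V i) where
  open ≡-Reasoning

  periodic-* : ∀ q i → V (q ℕ.* k ℕ.+ i) ≡ V i
  periodic-* zero    i = ≡.refl
  periodic-* (suc q) i = begin
    V (k ℕ.+ q ℕ.* k ℕ.+ i)     ≡⟨ ≡.cong V (ℕ.+-assoc k (q ℕ.* k) i) ⟩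
    V (k ℕ.+ (q ℕ.* k ℕ.+ i))   ≡⟨ periodic (q ℕ.* k ℕ.+ i) ⟩
    V (q ℕ.* k ℕ.+ i)           ≡⟨ periodic-* q i ⟩
    V i                         ∎

  periodic⇒reindex : .{{_ : NonZero k}} → ∀ j i → ∃[ u ] u ℕ.< k × V i ≡ V (u ℕ.+ j)
  periodic⇒reindex j i = u % k , m%n<n u k , (begin
    V i                                 ≡⟨ periodic-* j i ⟨
    V (j ℕ.* k ℕ.+ i)                   ≡⟨ ≡.cong V (ℕ.m∸n+n≡m (ℕ.≤-trans (ℕ.m≤m*n j k) (ℕ.m≤m+n _ i))) ⟨
    V (u ℕ.+ j)                         ≡⟨ ≡.cong (λ w → V (w ℕ.+ j)) (≡.trans (m≡m%n+[m/n]*n u k) (ℕ.+-comm (u % k) _)) ⟩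
    V (u / k ℕ.* k ℕ.+ u % k ℕ.+ j)     ≡⟨ ≡.cong V (ℕ.+-assoc (u / k ℕ.* k) (u % k) j) ⟩
    V (u / k ℕ.* k ℕ.+ (u % k ℕ.+ j))   ≡⟨ periodic-* (u / k) _ ⟩
    V (u % k ℕ.+ j)                     ∎)
    where
    -- Adding `j` full periods first makes the truncated subtraction of `j` exact.
    u = j ℕ.* k ℕ.+ i ℕ.∸ j

-- Width of the polygon and interior chords

module Arrangement (ℝ : CompleteOrderedField) {k : ℕ} {V : ℕ → Plane.Point ℝ} {P : Pred (Plane.Point ℝ) 0ℓ}
  (regular : CrossProduct.RegularSequence ℝ k V) (hull : ConvexHull.IsHull ℝ P V)
  (m h : ℕ) (h+m≡k : h ℕ.+ m ≡ k) (h≡m⊎1+m : h ≡ m ⊎ h ≡ suc m) where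
  open CompleteOrderedField ℝ
  open Plane ℝ
  open OrderedField ℝ
  open CrossProduct ℝ
  open RegularSequence regular
  open ConvexHull.IsHull hull
  open Turning ℝ regular
  open DifferenceBody ℝ P-convex
  open Solver using (solve; con; _:=_; _:+_; _:*_; :-_; _:-_)
  open ≤-Reasoning

  private
    m≤h : m ℕ.≤ h
    m≤h = [ ℕ.≤-reflexive ∘ ≡.sym , (λ eq → ℕ.≤-trans (ℕ.n≤1+n m) (ℕ.≤-reflexive (≡.sym eq))) ]′ h≡m⊎1+m

    h≤1+m : h ℕ.≤ suc m
    h≤1+m = [ (λ eq → ℕ.≤-trans (ℕ.≤-reflexive eq) (ℕ.n≤1+n m)) , ℕ.≤-reflexive ]′ h≡m⊎1+m

    2m≤k : m ℕ.+ m ℕ.≤ k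
    2m≤k = ≡.subst (m ℕ.+ m ℕ.≤_) h+m≡k (ℕ.+-monoˡ-≤ m m≤h)

    k≤2m+1 : k ℕ.≤ suc (m ℕ.+ m)
    k≤2m+1 = ≡.subst (ℕ._≤ suc (m ℕ.+ m)) h+m≡k (ℕ.+-monoˡ-≤ m h≤1+m)

  -- The greatest height over an edge, that is, the width of P across that edge scaled by the edge
  -- length.
  W : Carrier
  W = H (suc m)

  -- For odd `k` the index `h` is the peak `suc m` itself. For even `k` it is `m`, and the edge from
  -- vertex `m` to vertex `suc m` is parallel to edge 0 because a half turn has sine zero.
  H-h : H h ≈ W
  H-h = [ even , reflexive ∘ ≡.cong H ]′ h≡m⊎1+m
    where
    even : h ≡ m → H h ≈ W
    even h≡m = begin-equality
      H h         ≡⟨ ≡.cong H h≡m ⟩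
      H m         ≈⟨ +-identityʳ _ ⟨
      H m + 0#    ≈⟨ +-congˡ (S-half m (≡.trans (≡.cong (ℕ._+ m) (≡.sym h≡m)) h+m≡k)) ⟨
      H (suc m)   ∎

  W-max : ∀ u → u ℕ.≤ k → H u ≤ W
  W-max = H-max m 2m≤k k≤2m+1

  W-pos : 0# < W
  W-pos = begin-strict
    0#   <⟨ H-pos 2 ℕ.≤-refl 3≤k ⟩
    H 2  ≤⟨ W-max 2 (ℕ.<⇒≤ 3≤k) ⟩
    W    ∎

  P-heights : ∀ j {p} → p ∈ P → 0# ≤ cross (e j) (p -ₚ V j) × cross (e j) (p -ₚ V j) ≤ W
  P-heights j = P-bounds (proj₁ ∘ vertex) (proj₂ ∘ vertex)
    where
    instance
      k≢0 : NonZero k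
      k≢0 = ℕ.>-nonZero (ℕ.<-trans (ℕ.s≤s ℕ.z≤n) 3≤k)
    vertex : ∀ i → 0# ≤ cross (e j) (V i -ₚ V j) × cross (e j) (V i -ₚ V j) ≤ W
    vertex i with periodic⇒reindex k V periodic j i
    ... | u , u<k , eq rewrite eq =
        ≤-respʳ-≈ (sym (height j u)) (H-nonNeg u u<k)
      , ≤-respˡ-≈ (sym (height j u)) (W-max u (ℕ.<⇒≤ u<k))

  -- P lies in a strip of width `W` along edge `j`. Exceeding this bound is what separates
  -- conflicting copies.
  E-height : ∀ j {x} → x ∈ E → cross (e j) x ≤ W + W
  E-height j {x} (p , q , p∈P , q∈P , x≈) = begin
    cross (e j) x
      ≈⟨ trans (cross-cong ≈ₚ-refl x≈) (expand (e j) (V j) p q) ⟩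
    cross (e j) (p -ₚ V j) + cross (e j) (p -ₚ V j) - (cross (e j) (q -ₚ V j) + cross (e j) (q -ₚ V j))
      ≤⟨ +-mono-≤ (+-mono-≤ fp≤W fp≤W) (0≤y-x⇒x≤y (≤-respʳ-≈
           (solve 1 (λ u → u :+ u := con (+ 0) :- :- (u :+ u)) refl (cross (e j) (q -ₚ V j)))
           (+-nonNeg 0≤fq 0≤fq))) ⟩
    W + W + 0#
      ≈⟨ +-identityʳ _ ⟩
    W + W ∎
    where
    fp≤W = proj₂ (P-heights j p∈P)
    0≤fq = proj₁ (P-heights j q∈P)
    expand : ∀ a o p q → cross a (2# *ₚ p -ₚ 2# *ₚ q) ≈
      cross a (p -ₚ o) + cross a (p -ₚ o) - (cross a (q -ₚ o) + cross a (q -ₚ o))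
    expand (a₁ , a₂) (o₁ , o₂) (p₁ , p₂) (q₁ , q₂) = solve 8 (λ a₁ a₂ o₁ o₂ p₁ p₂ q₁ q₂ →
      let two = con (+ 1) :+ con (+ 1)
          f = λ x y → a₁ :* (y :- o₂) :- a₂ :* (x :- o₁)
      in a₁ :* (two :* p₂ :- two :* q₂) :- a₂ :* (two :* p₁ :- two :* q₁)
           := f p₁ p₂ :+ f p₁ p₂ :- (f q₁ q₂ :+ f q₁ q₂)) refl a₁ a₂ o₁ o₂ p₁ p₂ q₁ q₂

  -- The length condition is part of the predicate, so that one margin can be chosen for all `d` at
  -- once.
  ShortChordsInterior : Carrier → ℕ → Set
  ShortChordsInterior η d = suc d ℕ.+ suc d ℕ.< k → ∀ i → V (suc d ℕ.+ i) -ₚ V (suc i) ∈ Interior η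

  short-chords-interior : ∀ d → ∃[ η ] 0# < η × η ≤ 1# × ShortChordsInterior η d
  short-chords-interior d with suc d ℕ.+ suc d ℕ.<? k
  ... | no ¬short = 1# , 0<1 , ≤-refl , λ short → contradiction short ¬short
  ... | yes short = η₀ , 0<η₀ , η₀≤1 , λ _ i →
      proj₂ (proj₂ (proj₂ (shrunk-interior 0≤h 0<s (trapezoid d i) (D-difference (V∈P _) (V∈P _)))))
    where
    0≤h = H-nonNeg (suc d) (ℕ.≤-<-trans (ℕ.m≤m+n (suc d) (suc d)) short)
    0<s = S-pos d short
    -- The margin is computed from `0≤h` and `0<s` only, so its value for the chord at index 0 is
    -- definitionally its value at every `i`.
    first = shrunk-interior 0≤h 0<s (trapezoid d 0) (D-difference (V∈P _) (V∈P _))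
    η₀ = proj₁ first
    0<η₀ = proj₁ (proj₂ first)
    η₀≤1 = proj₁ (proj₂ (proj₂ first))

  all-short-chords-interior : ∀ n → ∃[ η ] 0# < η × η ≤ 1# × (∀ d → d ℕ.< n → ShortChordsInterior η d)
  all-short-chords-interior zero    = 1# , 0<1 , ≤-refl , λ _ ()
  all-short-chords-interior (suc n) with short-chords-interior n | all-short-chords-interior n
  ... | η , 0<η , η≤1 , I | θ , 0<θ , θ≤1 , J =
      -- The product replaces a minimum: both margins are at most one, so it is below each of them.
      η * θ , *-pos 0<η 0<θ
    , ≤-trans (*-monoˡ-≤ (proj₁ 0<η) θ≤1) (≤-respˡ-≈ (sym (*-identityʳ η)) η≤1)
    , λ d d<1+n → extend d (ℕ.m≤n⇒m<n∨m≡n (ℕ.s≤s⁻¹ d<1+n))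
    where
    extend : ∀ d → d ℕ.< n ⊎ d ≡ n → ShortChordsInterior (η * θ) d
    extend d (inj₁ d<n) short i y∈D = D-resp (swap , swap)
      (interior-scale (proj₁ 0<η) η≤1 (λ {y} → J d d<n short i {y}) y∈D)
      where
      swap : ∀ {x y} → x + θ * η * y ≈ x + η * θ * y
      swap = +-congˡ (*-congʳ (*-comm θ η))
    extend d (inj₂ ≡.refl) short i y∈D = interior-scale (proj₁ 0<θ) θ≤1 (λ {y} → I short i {y}) y∈D

  private
    common = all-short-chords-interior k
    η = proj₁ common
    0<η : 0# < η
    0<η = proj₁ (proj₂ common)
    η≤1 : η ≤ 1#
    η≤1 = proj₁ (proj₂ (proj₂ common))

  short-chord : ∀ d i → suc d ℕ.+ suc d ℕ.< k → V (suc d ℕ.+ i) -ₚ V (suc i) ∈ Interior η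
  short-chord d i short = proj₂ (proj₂ (proj₂ common)) d
    (ℕ.<-trans (ℕ.s≤s (ℕ.m≤m+n d (suc d))) short) short i

  -- Anchors of different directions overlap robustly

  -- Twice the midpoint of edge j, and twice the point of P opposite to it: an edge midpoint
  -- for even k and a vertex for odd k.
  -- Since 2P − 2P is symmetric, translating by these points instead of by their negatives
  -- does not change which translates meet.
  anchor : Bool → ℕ → Point
  anchor false j = V j +ₚ V (suc j)
  anchor true  j = V (h ℕ.+ j) +ₚ V (suc m ℕ.+ j)

  -- A chord from the opposite side back to edge `j`, of height -`W` over it. Both families of
  -- direction `j` move along it, so the relative displacement of two members depends only on the
  -- difference of their ranks.
  shift : ℕ → Point
  shift j = V (suc j) -ₚ V (suc m ℕ.+ j)

  V∸V∈D : ∀ i j → V i -ₚ V j ∈ D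
  V∸V∈D i j = D-difference (V∈P i) (V∈P j)

  overlap-refl : ∀ s j → Overlap η (anchor s j) (anchor s j)
  -- The chord with `d` = 0 joins a vertex to itself, which makes the zero vector interior.
  overlap-refl s j = _ , _ , short-chord 0 0 3≤k , V∸V∈D 0 0 , zeros , zeros
    where
    zeros : ∀ {x y z} → x - x ≈ (y - y) + (z - z)
    zeros {x} {y} {z} = solve 3 (λ x y z → x :- x := (y :- y) :+ (z :- z)) refl x y z

  private
    -- Counts the `d` edges from the end of edge `suc c + j` to vertex `h + j` opposite edge `j`.
    -- The offset of at least one between the directions is what makes this chord short.
    chord-length : ∀ c j → suc c ℕ.+ j ℕ.< m → ∃[ d ] suc d ℕ.+ suc c ≡ h × suc d ℕ.+ suc d ℕ.< k
    chord-length c j lt = d , eq , (ℕ.<-≤-trans (ℕ.+-monoʳ-< (suc d) d<)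
      (ℕ.≤-reflexive (≡.trans (≡.sym (ℕ.+-assoc (suc d) (suc c) m)) (≡.trans (≡.cong (ℕ._+ m) eq) h+m≡k))))
      where
      d = h ℕ.∸ suc (suc c)
      1+c<m : suc c ℕ.< m
      1+c<m = ℕ.≤-<-trans (ℕ.m≤m+n (suc c) j) lt
      eq : suc d ℕ.+ suc c ≡ h
      eq = ≡.trans (≡.sym (ℕ.+-suc d (suc c))) (ℕ.m∸n+n≡m (ℕ.≤-trans 1+c<m m≤h))
      d< : suc d ℕ.< suc c ℕ.+ m
      d< = ℕ.s≤s (ℕ.≤-trans (ℕ.s≤s⁻¹ (ℕ.≤-trans (ℕ.≤-trans (ℕ.m≤m+n (suc (suc d)) c)
             (ℕ.≤-reflexive (≡.trans (≡.sym (ℕ.+-suc (suc d) c)) eq))) h≤1+m)) (ℕ.m≤n+m m c))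

    reachable : ∀ {p q} → p ≡ q → ∀ {r} → p -ₚ r ∈ Interior η → q -ₚ r ∈ Interior η
    reachable ≡.refl I {y} = I {y}

  -- In each of the four cases one crosswise pair of anchor vertices spans a short chord, which is
  -- interior; the other chord is only used as a member of `D`.
  overlap-offset : ∀ c j → suc c ℕ.+ j ℕ.< m → ∀ s s′ → Overlap η (anchor s (suc c ℕ.+ j)) (anchor s′ j)
  overlap-offset c j lt false false = overlap-sums η (λ {y} → short-chord c j short {y}) (V∸V∈D _ _)
    where
    1+c<m : suc c ℕ.< m
    1+c<m = ℕ.≤-<-trans (ℕ.m≤m+n (suc c) j) lt
    short : suc c ℕ.+ suc c ℕ.< k
    short = ℕ.<-≤-trans (ℕ.+-mono-< 1+c<m 1+c<m) 2m≤k
  overlap-offset c j lt true true = overlap-sums η (λ {y} → chord h≡m⊎1+m {y}) (V∸V∈D _ _)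
    where
    1+c<m : suc c ℕ.< m
    1+c<m = ℕ.≤-<-trans (ℕ.m≤m+n (suc c) j) lt
    chord : h ≡ m ⊎ h ≡ suc m → V (h ℕ.+ (suc c ℕ.+ j)) -ₚ V (suc m ℕ.+ j) ∈ Interior η
    chord (inj₁ h≡m) = reachable (≡.cong V (≡.trans (x∙yz≈y∙xz (suc c) m j) (≡.cong (ℕ._+ (suc c ℕ.+ j)) (≡.sym h≡m))))
      (λ {y} → short-chord c (m ℕ.+ j) (ℕ.<-≤-trans (ℕ.+-mono-< 1+c<m 1+c<m) 2m≤k) {y})
    -- For odd `k` this chord is one edge longer, spanning c + 1 edges; it is still short since 2(c
    -- + 2) ≤ 2m < k.
    chord (inj₂ h≡1+m) = reachable (≡.cong V (≡.trans (≡.cong suc (x∙yz≈y∙xz (suc c) m j)) (≡.cong (ℕ._+ (suc c ℕ.+ j)) (≡.sym h≡1+m))))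
      (λ {y} → short-chord (suc c) (m ℕ.+ j) (ℕ.≤-<-trans (ℕ.+-mono-≤ 1+c<m 1+c<m)
        (ℕ.≤-reflexive (≡.trans (≡.cong (ℕ._+ m) (≡.sym h≡1+m)) h+m≡k))) {y})
  overlap-offset c j lt false true with chord-length c j lt
  ... | d , eq , short = overlap-swap η (overlap-sums η
      (λ {y} → reachable (≡.cong V index) (λ {y} → short-chord d (suc c ℕ.+ j) short {y}) {y}) (V∸V∈D _ _))
    where
    index : suc d ℕ.+ (suc c ℕ.+ j) ≡ h ℕ.+ j
    index = ≡.trans (≡.sym (ℕ.+-assoc (suc d) (suc c) j)) (≡.cong (ℕ._+ j) eq)
  overlap-offset c j lt true false with chord-length c j lt
  ... | d , eq , short = overlap-swap η (overlap-sums η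
      -- This chord runs forward from the far anchor to edge `j` one period later, so its end `V j`
      -- is read as `V (k + j)`.
      (λ {y} → reachable (≡.trans (≡.cong V index) (periodic j))
        (λ {y} → short-chord d (m ℕ.+ (suc c ℕ.+ j)) short {y}) {y}) (V∸V∈D _ _))
    where
    index : suc d ℕ.+ (m ℕ.+ (suc c ℕ.+ j)) ≡ k ℕ.+ j
    index = ≡.trans (rearrange (suc d) m (suc c) j) (≡.cong (ℕ._+ j) (≡.trans (≡.cong (ℕ._+ m) eq) h+m≡k))
      where
      open import Data.Nat.Solver using (module +-*-Solver)
      rearrange : ∀ a b c d → a ℕ.+ (b ℕ.+ (c ℕ.+ d)) ≡ a ℕ.+ c ℕ.+ b ℕ.+ d
      rearrange = +-*-Solver.solve 4 (λ a b c d → a N.:+ (b N.:+ (c N.:+ d)) N.:= a N.:+ c N.:+ b N.:+ d) ≡.refl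
        where module N = +-*-Solver

  overlap-< : ∀ {a b} → a ℕ.< b → b ℕ.< m → ∀ s s′ → Overlap η (anchor s b) (anchor s′ a)
  overlap-< {a} {b} a<b b<m with b ℕ.∸ suc a | ≡.trans (≡.sym (ℕ.+-suc (b ℕ.∸ suc a) a)) (ℕ.m∸n+n≡m a<b)
  ... | c | ≡.refl = overlap-offset c a b<m

  overlap-≢ : ∀ s s′ (j j′ : Fin m) → j ≢ j′ → Overlap η (anchor s (toℕ j)) (anchor s′ (toℕ j′))
  overlap-≢ s s′ j j′ j≢j′ with ℕ.<-cmp (toℕ j) (toℕ j′)
  ... | tri≈ _ eq _ = contradiction (Fin.toℕ-injective eq) j≢j′
  ... | tri> _ _ gt = overlap-< gt (Fin.toℕ<n j) s s′
  ... | tri< lt _ _ = overlap-swap η (overlap-< lt (Fin.toℕ<n j′) s′ s)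

  -- Positions of the copies and their intersections

  module _ (N : ℕ) .{{_ : NonZero N}} where
    private
      1/2N : ∃[ t ] 0# < t × fromℕ (N ℕ.+ N) * t ≈ 1#
      1/2N = pos-inverse (fromℕ-pos (N ℕ.+ N) {{ℕ.>-nonZero (ℕ.<-≤-trans (ℕ.>-nonZero⁻¹ N) (ℕ.m≤m+n N N))}})
      t : Carrier
      t = proj₁ 1/2N
      0<t : 0# < t
      0<t = proj₁ (proj₂ 1/2N)
      2Nt≈1 : fromℕ (N ℕ.+ N) * t ≈ 1#
      2Nt≈1 = proj₂ (proj₂ 1/2N)

    -- Ranks up to `N` are scaled by 1/(2N), so that any two offsets sum to at most one, as
    -- `overlap⇒E` requires.
    offset : ℕ → Carrier
    offset a = t * fromℕ a

    offset-nonNeg : ∀ a → 0# ≤ offset a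
    offset-nonNeg a = *-nonNeg (proj₁ 0<t) (fromℕ-nonNeg a)

    offset-mono-≤ : ∀ {a b} → a ℕ.≤ b → offset a ≤ offset b
    offset-mono-≤ a≤b = *-monoˡ-≤ (proj₁ 0<t) (fromℕ-mono-≤ a≤b)

    offset-mono-< : ∀ {a b} → a ℕ.< b → 0# < offset b - offset a
    offset-mono-< {a} {b} a<b = begin-strict
      0#                        <⟨ 0<t ⟩
      t                         ≈⟨ solve 2 (λ t a → t := t :* (con (+ 1) :+ a) :- t :* a) refl t (fromℕ a) ⟩
      offset (suc a) - offset a ≤⟨ +-monoˡ-≤ _ (offset-mono-≤ a<b) ⟩
      offset b - offset a       ∎

    offsets-≤1 : ∀ {a b} → a ℕ.≤ N → b ℕ.≤ N → offset a + offset b ≤ 1#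
    offsets-≤1 {a} {b} a≤N b≤N = begin
      offset a + offset b    ≈⟨ distribˡ _ _ _ ⟨
      t * (fromℕ a + fromℕ b) ≈⟨ *-congˡ (fromℕ-+ a b) ⟨
      t * fromℕ (a ℕ.+ b)    ≤⟨ offset-mono-≤ (ℕ.+-mono-≤ a≤N b≤N) ⟩
      t * fromℕ (N ℕ.+ N)    ≈⟨ *-comm _ _ ⟩
      fromℕ (N ℕ.+ N) * t    ≈⟨ 2Nt≈1 ⟩
      1#                     ∎

    position : Label m → Point
    position (j , s , a) = anchor s (toℕ j) +ₚ (η * offset a) *ₚ shift (toℕ j)

    flip-difference : ∀ {p q} → -ₚ (p -ₚ q) ≈ₚ q -ₚ p
    flip-difference = -‿flip refl , -‿flip refl

    -- The difference is one chord from the opposite side to edge `j` plus a second such chord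
    -- shrunk by 1 - `τ`; both summands lie in `D`.
    near-far-touch : ∀ j {a b} → a ℕ.≤ b → b ℕ.≤ N → position (j , false , a) -ₚ position (j , true , b) ∈ E
    near-far-touch j {a} {b} a≤b b≤N = E-resp (coordinate , coordinate)
      (D+D⊆E (V∸V∈D i (h ℕ.+ i)) (D-scale 0≤1-τ (≤-by 0≤τ (solve 1 (λ τ → con (+ 1) := con (+ 1) :- τ :+ τ) refl τ))
        (V∸V∈D (suc i) (suc m ℕ.+ i))))
      where
      i = toℕ j
      τ = η * (offset b - offset a)
      0≤τ : 0# ≤ τ
      0≤τ = *-nonNeg (proj₁ 0<η) (x≤y⇒0≤y-x (offset-mono-≤ a≤b))
      0≤1-τ : 0# ≤ 1# - τ
      0≤1-τ = x≤y⇒0≤y-x (begin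
        η * (offset b - offset a)    ≤⟨ *-monoʳ-≤ (x≤y⇒0≤y-x (offset-mono-≤ a≤b)) η≤1 ⟩
        1# * (offset b - offset a)   ≤⟨ ≤-by (+-nonNeg (offset-nonNeg a) (offset-nonNeg a)) (solve 2 (λ a b →
                                          b :+ a := con (+ 1) :* (b :- a) :+ (a :+ a)) refl (offset a) (offset b)) ⟩
        offset b + offset a          ≤⟨ offsets-≤1 b≤N (ℕ.≤-trans a≤b b≤N) ⟩
        1#                           ∎)
      coordinate : ∀ {x y z w} → (x - z) + (1# - τ) * (y - w) ≈
        ((x + y) + η * offset a * (y - w)) - ((z + w) + η * offset b * (y - w))
      coordinate {x} {y} {z} {w} = solve 7 (λ x y z w η a b →
        (x :- z) :+ (con (+ 1) :- η :* (b :- a)) :* (y :- w)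
          := ((x :+ y) :+ η :* a :* (y :- w)) :- ((z :+ w) :+ η :* b :* (y :- w)))
        refl x y z w η (offset a) (offset b)

    -- With the ranks in this order the second chord is stretched by 1 + `τ` instead, and the height
    -- (2 + τ) W over edge `j` exceeds what `E` allows.
    near-far-apart : ∀ j {a b} → b ℕ.< a → ¬ position (j , true , b) -ₚ position (j , false , a) ∈ E
    near-far-apart j {a} {b} b<a x∈E = <⇒≱ (begin-strict
      W + W                                     <⟨ <-by (*-pos 0<τ W-pos)
                                                     (solve 2 (λ w τ → w :+ (con (+ 1) :+ τ) :* w := w :+ w :+ τ :* w) refl W τ) ⟩
      W + (1# + τ) * W                          ≈⟨ +-cong (trans (height i h) H-h) (*-congˡ (height i (suc m))) ⟨
      cross (e i) (V (h ℕ.+ i) -ₚ V i) + (1# + τ) * cross (e i) (V (suc m ℕ.+ i) -ₚ V i)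
        ≈⟨ expand (V i) (V (suc i)) (V (h ℕ.+ i)) (V (suc m ℕ.+ i)) ⟨
      cross (e i) (position (j , true , b) -ₚ position (j , false , a)) ∎)
      (E-height i x∈E)
      where
      i = toℕ j
      τ = η * (offset a - offset b)
      0<τ : 0# < τ
      0<τ = *-pos 0<η (offset-mono-< b<a)
      expand : ∀ p q r s → cross (q -ₚ p) (((r +ₚ s) +ₚ (η * offset b) *ₚ (q -ₚ s)) -ₚ ((p +ₚ q) +ₚ (η * offset a) *ₚ (q -ₚ s)))
        ≈ cross (q -ₚ p) (r -ₚ p) + (1# + τ) * cross (q -ₚ p) (s -ₚ p)
      expand (p₁ , p₂) (q₁ , q₂) (r₁ , r₂) (s₁ , s₂) = solve 11 (λ p₁ p₂ q₁ q₂ r₁ r₂ s₁ s₂ η a b →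
        let point = λ p q r s → ((r :+ s) :+ η :* b :* (q :- s)) :- ((p :+ q) :+ η :* a :* (q :- s))
            f = λ x y → (q₁ :- p₁) :* y :- (q₂ :- p₂) :* x
        in f (point p₁ q₁ r₁ s₁) (point p₂ q₂ r₂ s₂)
             := f (r₁ :- p₁) (r₂ :- p₂) :+ (con (+ 1) :+ η :* (a :- b)) :* f (s₁ :- p₁) (s₂ :- p₂))
        refl p₁ p₂ q₁ q₂ r₁ r₂ s₁ s₂ η (offset a) (offset b)

    overlap⇒touch : ∀ {j s a j′ s′ b} → a ℕ.≤ N → b ℕ.≤ N → Overlap η (anchor s (toℕ j)) (anchor s′ (toℕ j′)) →
      position (j , s , a) -ₚ position (j′ , s′ , b) ∈ E
    overlap⇒touch {a = a} {b = b} a≤N b≤N = overlap⇒E η (offset-nonNeg a) (offset-nonNeg b) (offsets-≤1 a≤N b≤N)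
      (V∸V∈D _ _) (V∸V∈D _ _)

    ¬conflict⇒touch : ∀ l l′ → proj₂ (proj₂ l) ℕ.≤ N → proj₂ (proj₂ l′) ℕ.≤ N →
      ¬ Conflict l l′ → position l -ₚ position l′ ∈ E
    ¬conflict⇒touch (j , s , a) (j′ , s′ , b) a≤N b≤N ¬c with j Fin.≟ j′
    ... | no j≢j′ = overlap⇒touch {j} {s} {a} {j′} {s′} a≤N b≤N (overlap-≢ s s′ j j′ j≢j′)
    ¬conflict⇒touch (j , false , a) (j , false , b) a≤N b≤N ¬c | yes ≡.refl = overlap⇒touch {j} {false} {a} {j} {false} a≤N b≤N (overlap-refl false (toℕ j))
    ¬conflict⇒touch (j , true  , a) (j , true  , b) a≤N b≤N ¬c | yes ≡.refl = overlap⇒touch {j} {true} {a} {j} {true} a≤N b≤N (overlap-refl true (toℕ j))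
    ¬conflict⇒touch (j , false , a) (j , true  , b) a≤N b≤N ¬c | yes ≡.refl =
      near-far-touch j (ℕ.≮⇒≥ λ b<a → ¬c (≡.refl , b<a)) b≤N
    ¬conflict⇒touch (j , true  , a) (j , false , b) a≤N b≤N ¬c | yes ≡.refl =
      E-resp flip-difference (E-neg (near-far-touch j (ℕ.≮⇒≥ λ a<b → ¬c (≡.refl , a<b)) a≤N))

    conflict⇒apart : ∀ l l′ → Conflict l l′ → ¬ position l -ₚ position l′ ∈ E
    conflict⇒apart (j , false , a) (j , true  , b) (≡.refl , b<a) x∈E =
      near-far-apart j b<a (E-resp flip-difference (E-neg x∈E))
    conflict⇒apart (j , true  , a) (j , false , b) (≡.refl , a<b) x∈E = near-far-apart j a<b x∈E

-- Growth estimates and real exponents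

^-cancelˡ-≤ : ∀ e .{{_ : NonZero e}} {a b} → a ℕ.^ e ℕ.≤ b ℕ.^ e → a ℕ.≤ b
^-cancelˡ-≤ e {a} {b} le with a ℕ.≤? b
... | yes a≤b = a≤b
... | no  a≰b = contradiction le (ℕ.<⇒≱ (ℕ.^-monoˡ-< e (ℕ.≰⇒> a≰b)))

^-distrib-*ℕ : ∀ a b e → (a ℕ.* b) ℕ.^ e ≡ a ℕ.^ e ℕ.* b ℕ.^ e
^-distrib-*ℕ a b zero    = ≡.refl
^-distrib-*ℕ a b (suc e) = ≡.trans (≡.cong (a ℕ.* b ℕ.*_) (^-distrib-*ℕ a b e))
  (ℕ.[m*n]*[o*p]≡[m*o]*[n*p] a b (a ℕ.^ e) (b ℕ.^ e))

-- Once the quotient r is at least one, 1 + r ≤ 2r pays for rounding down.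
n≤4m[n/2/m] : ∀ m .{{_ : NonZero m}} {n} → m ℕ.* 2 ℕ.≤ n → n ℕ.≤ 4 ℕ.* m ℕ.* (n / 2 / m)
n≤4m[n/2/m] m {n} 2m≤n = begin
  n                                    ≡⟨ m≡m%n+[m/n]*n n 2 ⟩
  n % 2 ℕ.+ n / 2 ℕ.* 2                ≤⟨ ℕ.+-monoˡ-≤ _ (ℕ.<⇒≤ (m%n<n n 2)) ⟩
  (1 ℕ.+ n / 2) ℕ.* 2                  ≤⟨ ℕ.*-monoˡ-≤ 2 h<[1+r]m ⟩
  (1 ℕ.+ r) ℕ.* m ℕ.* 2                ≤⟨ ℕ.*-monoˡ-≤ 2 (ℕ.*-monoˡ-≤ m (ℕ.+-monoˡ-≤ r 1≤r)) ⟩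
  (r ℕ.+ r) ℕ.* m ℕ.* 2                ≡⟨ solve 2 (λ r m → (r :+ r) :* m :* con 2 := con 4 :* m :* r) ≡.refl r m ⟩
  4 ℕ.* m ℕ.* r                        ∎
  where
  open ℕ.≤-Reasoning
  open import Data.Nat.Solver using (module +-*-Solver)
  open +-*-Solver using (solve; con; _:=_; _:+_; _:*_)
  r = n / 2 / m
  1≤r : 1 ℕ.≤ r
  1≤r = m≥n⇒m/n>0 (≡.subst (ℕ._≤ n / 2) (m*n/n≡m m 2) (/-monoˡ-≤ 2 2m≤n))
  h<[1+r]m : 1 ℕ.+ n / 2 ℕ.≤ (1 ℕ.+ r) ℕ.* m
  h<[1+r]m = begin
    1 ℕ.+ n / 2                   ≡⟨ ≡.cong suc (m≡m%n+[m/n]*n (n / 2) m) ⟩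
    suc (n / 2 % m ℕ.+ r ℕ.* m)   ≤⟨ ℕ.+-monoˡ-≤ (r ℕ.* m) (m%n<n (n / 2) m) ⟩
    m ℕ.+ r ℕ.* m                 ∎

module Growth (ℝ : CompleteOrderedField) where
  open CompleteOrderedField ℝ
  open OrderedField ℝ
  open RealPower ℝ
  open Solver using (solve; con; _:=_; _:+_; _:*_; :-_; _:-_)
  open SemiringExp semiring using (^-homo-*; ^-assocʳ)

  supremum-≤ : ∀ S ne bd y → (∀ x → x ∈ S → x ≤ y) → proj₁ (supremum S ne bd) ≤ y
  supremum-≤ S ne bd y ub with proj₁ (supremum S ne bd) ≤? y
  ... | yes s≤y = s≤y
  ... | no  s≰y with proj₂ (proj₂ (supremum S ne bd)) y (≰⇒> s≰y)
  ... | x , x∈S , y<x = contradiction (ub x x∈S) (<⇒≱ y<x)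

  -- For positive `q`, division by `q * e` turns the claim into 1/e + (a - b)/q ≤ M: the loss
  -- `M * ε` in the exponent is at least 1/e.
  exponent-bound : ∀ e q M a b ε .{{_ : NonZero M}} → 1# ≤ fromℕ e * ε →
    fromℕ a ≤ fromℕ q * (fromℕ M * (1# - ε)) + fromℕ b →
    q ℕ.+ a ℕ.* e ℕ.≤ (M ℕ.* q ℕ.+ b) ℕ.* e
  exponent-bound e q M a b ε 1≤eε a≤ = fromℕ-cancel-≤ (begin
    fromℕ (q ℕ.+ a ℕ.* e)
      ≈⟨ trans (fromℕ-+ q (a ℕ.* e)) (+-congˡ (fromℕ-* a e)) ⟩
    fromℕ q + fromℕ a * fromℕ e
      ≤⟨ +-mono-≤ q≤qMeε (*-monoʳ-≤ (fromℕ-nonNeg e) a≤) ⟩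
    fromℕ q * (fromℕ M * (fromℕ e * ε)) + (fromℕ q * (fromℕ M * (1# - ε)) + fromℕ b) * fromℕ e
      ≈⟨ solve 5 (λ e q M b ε → q :* (M :* (e :* ε)) :+ (q :* (M :* (con (+ 1) :- ε)) :+ b) :* e
                    := (M :* q :+ b) :* e) refl (fromℕ e) (fromℕ q) (fromℕ M) (fromℕ b) ε ⟩
    (fromℕ M * fromℕ q + fromℕ b) * fromℕ e
      ≈⟨ *-congʳ (trans (fromℕ-+ (M ℕ.* q) b) (+-congʳ (fromℕ-* M q))) ⟨
    fromℕ (M ℕ.* q ℕ.+ b) * fromℕ e
      ≈⟨ fromℕ-* (M ℕ.* q ℕ.+ b) e ⟨
    fromℕ ((M ℕ.* q ℕ.+ b) ℕ.* e) ∎)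
    where
    open ≤-Reasoning
    q≤qMeε : fromℕ q ≤ fromℕ q * (fromℕ M * (fromℕ e * ε))
    q≤qMeε = begin
      fromℕ q                               ≈⟨ trans (*-congˡ (*-identityʳ 1#)) (*-identityʳ _) ⟨
      fromℕ q * (1# * 1#)                   ≤⟨ *-monoˡ-≤ (fromℕ-nonNeg q) (≤-trans
        (*-monoʳ-≤ 0≤1 (≤-respˡ-≈ (+-identityʳ 1#) (fromℕ-mono-≤ {1} (ℕ.>-nonZero⁻¹ M))))
        (*-monoˡ-≤ (fromℕ-nonNeg M) 1≤eε)) ⟩
      fromℕ q * (fromℕ M * (fromℕ e * ε))   ∎

  -- The bound on `K` by the e-th root of `n` is available only as `K ^ e` ≤ `n`, so both sides are
  -- compared after raising them to the power `e`.
  power-bound : ∀ K e n .{{_ : NonZero e}} .{{_ : NonZero n}} → K ℕ.^ e ℕ.≤ n → ∀ q a s →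
    q ℕ.+ a ℕ.* e ℕ.≤ s ℕ.* e → K ℕ.^ q ℕ.* n ℕ.^ a ℕ.≤ n ℕ.^ s
  power-bound K e n K^e≤n q a s le = ^-cancelˡ-≤ e (begin
    (K ℕ.^ q ℕ.* n ℕ.^ a) ℕ.^ e           ≡⟨ ^-distrib-*ℕ (K ℕ.^ q) (n ℕ.^ a) e ⟩
    (K ℕ.^ q) ℕ.^ e ℕ.* (n ℕ.^ a) ℕ.^ e   ≡⟨ ≡.cong₂ ℕ._*_ (ℕ.^-*-assoc K q e) (ℕ.^-*-assoc n a e) ⟩
    K ℕ.^ (q ℕ.* e) ℕ.* n ℕ.^ (a ℕ.* e)   ≡⟨ ≡.cong (λ u → K ℕ.^ u ℕ.* n ℕ.^ (a ℕ.* e)) (ℕ.*-comm q e) ⟩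
    K ℕ.^ (e ℕ.* q) ℕ.* n ℕ.^ (a ℕ.* e)   ≡⟨ ≡.cong (ℕ._* n ℕ.^ (a ℕ.* e)) (ℕ.^-*-assoc K e q) ⟨
    (K ℕ.^ e) ℕ.^ q ℕ.* n ℕ.^ (a ℕ.* e)   ≤⟨ ℕ.*-monoˡ-≤ (n ℕ.^ (a ℕ.* e)) (ℕ.^-monoˡ-≤ q K^e≤n) ⟩
    n ℕ.^ q ℕ.* n ℕ.^ (a ℕ.* e)           ≡⟨ ℕ.^-distribˡ-+-* n q (a ℕ.* e) ⟨
    n ℕ.^ (q ℕ.+ a ℕ.* e)                 ≤⟨ ℕ.^-monoʳ-≤ n le ⟩
    n ℕ.^ (s ℕ.* e)                       ≡⟨ ℕ.^-*-assoc n s e ⟨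
    (n ℕ.^ s) ℕ.^ e                       ∎)
    where open ℕ.≤-Reasoning

  -- The loss in the exponent absorbs the constant `K`, which is at most n^(1/e). The inequality K x
  -- ≤ n^M is checked on powers with exponent q + 1, multiplied by n^b, where it reduces to one
  -- between natural numbers.
  rationalPower-≤ : ∀ K e n M C ε .{{_ : NonZero K}} .{{_ : NonZero e}} .{{_ : NonZero n}} .{{_ : NonZero M}} →
    1# ≤ fromℕ e * ε → K ℕ.^ e ℕ.≤ n → n ℕ.^ M ℕ.≤ K ℕ.* C →
    ∀ x → x ∈ IsRationalPowerUpTo n (fromℕ M * (1# - ε)) → x ≤ fromℕ C
  rationalPower-≤ K e n M C ε 1≤eε K^e≤n n^M≤KC x (0≤x , a , b , q , eq , a≤) =
    *-cancelˡ-≤ (fromℕ-pos K) (begin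
      fromℕ K * x         ≤⟨ ^-cancel-≤ q (proj₁ (^-pos 0<n M)) (*-cancelˡ-≤ (^-pos 0<n b) powers) ⟩
      fromℕ n ^ M         ≈⟨ fromℕ-^ n M ⟨
      fromℕ (n ℕ.^ M)     ≤⟨ fromℕ-mono-≤ n^M≤KC ⟩
      fromℕ (K ℕ.* C)     ≈⟨ fromℕ-* K C ⟩
      fromℕ K * fromℕ C   ∎)
    where
    open ≤-Reasoning
    0<n : 0# < fromℕ n
    0<n = fromℕ-pos n
    Q = suc q
    powers : fromℕ n ^ b * (fromℕ K * x) ^ Q ≤ fromℕ n ^ b * (fromℕ n ^ M) ^ Q
    powers = begin
      fromℕ n ^ b * (fromℕ K * x) ^ Q        ≈⟨ *-congˡ (^-distrib-* (fromℕ K) x Q) ⟩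
      fromℕ n ^ b * (fromℕ K ^ Q * x ^ Q)    ≈⟨ solve 3 (λ u v w → u :* (v :* w) := v :* (w :* u)) refl
                                                  (fromℕ n ^ b) (fromℕ K ^ Q) (x ^ Q) ⟩
      fromℕ K ^ Q * (x ^ Q * fromℕ n ^ b)    ≈⟨ *-congˡ eq ⟩
      fromℕ K ^ Q * fromℕ n ^ a              ≈⟨ *-cong (fromℕ-^ K Q) (fromℕ-^ n a) ⟨
      fromℕ (K ℕ.^ Q) * fromℕ (n ℕ.^ a)      ≈⟨ fromℕ-* (K ℕ.^ Q) (n ℕ.^ a) ⟨
      fromℕ (K ℕ.^ Q ℕ.* n ℕ.^ a)            ≤⟨ fromℕ-mono-≤ (power-bound K e n K^e≤n Q a (M ℕ.* Q ℕ.+ b)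
                                                  (exponent-bound e Q M a b ε 1≤eε a≤)) ⟩
      fromℕ (n ℕ.^ (M ℕ.* Q ℕ.+ b))          ≈⟨ fromℕ-^ n (M ℕ.* Q ℕ.+ b) ⟩
      fromℕ n ^ (M ℕ.* Q ℕ.+ b)              ≈⟨ ^-homo-* (fromℕ n) (M ℕ.* Q) b ⟩
      fromℕ n ^ (M ℕ.* Q) * fromℕ n ^ b      ≈⟨ *-comm _ _ ⟩
      fromℕ n ^ b * fromℕ n ^ (M ℕ.* Q)      ≈⟨ *-congˡ (^-assocʳ (fromℕ n) M Q) ⟨
      fromℕ n ^ b * (fromℕ n ^ M) ^ Q        ∎

  realPower-≤ : ∀ K e n M C ε .{{_ : NonZero K}} .{{_ : NonZero e}} .{{_ : NonZero n}} .{{_ : NonZero M}} →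
    1# ≤ fromℕ e * ε → K ℕ.^ e ℕ.≤ n → n ℕ.^ M ℕ.≤ K ℕ.* C →
    n ^ʳ (fromℕ M * (1# - ε)) ≤ fromℕ C
  realPower-≤ K e n M C ε 1≤eε K^e≤n n^M≤KC =
    supremum-≤ _ _ _ _ (rationalPower-≤ K e n M C ε 1≤eε K^e≤n n^M≤KC)

  archimedean-inverse : ∀ ε → 0# < ε → ∃[ e ] 1# ≤ fromℕ (suc e) * ε
  archimedean-inverse ε 0<ε with pos-inverse 0<ε
  ... | δ , _ , εδ≈1 with archimedean δ
  ... | e , δ≤e = e , (begin
    1#                  ≈⟨ εδ≈1 ⟨
    ε * δ               ≤⟨ *-monoˡ-≤ (proj₁ 0<ε) (≤-trans δ≤e (fromℕ-mono-≤ (ℕ.n≤1+n e))) ⟩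
    ε * fromℕ (suc e)   ≈⟨ *-comm _ _ ⟩
    fromℕ (suc e) * ε   ∎)
    where open ≤-Reasoning

-- Residues modulo k and halves

-- Without wrapping around, the sum exceeds `r` because `u` is positive; after wrapping, it falls
-- short of `r` because `u` is below `k`.
[u+r]%k≢r : ∀ {u r k} .{{_ : NonZero k}} → 0 ℕ.< u → u ℕ.< k → r ℕ.< k → (u ℕ.+ r) % k ≢ r
[u+r]%k≢r {u} {r} {k} 0<u u<k r<k eq with u ℕ.+ r ℕ.<? k
... | yes u+r<k = ℕ.<⇒≢ (ℕ.+-monoˡ-< r 0<u) (≡.sym (≡.trans (≡.sym (m<n⇒m%n≡m u+r<k)) eq))
... | no  u+r≮k = ℕ.<⇒≢ (ℕ.+-monoˡ-< r u<k) (begin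
    u ℕ.+ r                   ≡⟨ ℕ.m∸n+n≡m k≤u+r ⟨
    (u ℕ.+ r ℕ.∸ k) ℕ.+ k     ≡⟨ ≡.cong (ℕ._+ k) (≡.trans (≡.sym (m<n⇒m%n≡m small)) (≡.trans (m≤n⇒[n∸m]%m≡n%m k≤u+r) eq)) ⟩
    r ℕ.+ k                   ≡⟨ ℕ.+-comm r k ⟩
    k ℕ.+ r                   ∎)
  where
  open ≡-Reasoning
  k≤u+r : k ℕ.≤ u ℕ.+ r
  k≤u+r = ℕ.≮⇒≥ u+r≮k
  small : u ℕ.+ r ℕ.∸ k ℕ.< k
  small = ℕ.m<n+o⇒m∸n<o (u ℕ.+ r) k (ℕ.+-mono-< u<k r<k)

⌈n/2⌉≡⌊n/2⌋⊎ : ∀ n → ⌈ n /2⌉ ≡ ⌊ n /2⌋ ⊎ ⌈ n /2⌉ ≡ suc ⌊ n /2⌋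
⌈n/2⌉≡⌊n/2⌋⊎ 0             = inj₁ ≡.refl
⌈n/2⌉≡⌊n/2⌋⊎ 1             = inj₂ ≡.refl
⌈n/2⌉≡⌊n/2⌋⊎ (suc (suc n)) = Sum.map (≡.cong suc) (≡.cong suc) (⌈n/2⌉≡⌊n/2⌋⊎ n)

3≤k⇒⌊k/2⌋≢0 : ∀ {k} → 3 ℕ.≤ k → NonZero ⌊ k /2⌋
3≤k⇒⌊k/2⌋≢0 (ℕ.s≤s (ℕ.s≤s _)) = _

module _ {k : ℕ} .{{_ : NonZero k}} where

  toℕ-mod : ∀ i → toℕ (i mod k) ≡ i % k
  toℕ-mod i = Fin.toℕ-fromℕ< (m%n<n i k)

  mod-cong : ∀ i j → i % k ≡ j % k → i mod k ≡ j mod k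
  mod-cong i j eq = Fin.toℕ-injective (≡.trans (toℕ-mod i) (≡.trans eq (≡.sym (toℕ-mod j))))

  toℕ-mod-inverse : ∀ (i : Fin k) → toℕ i mod k ≡ i
  toℕ-mod-inverse i = Fin.toℕ-injective (≡.trans (toℕ-mod (toℕ i)) (m<n⇒m%n≡m (Fin.toℕ<n i)))

  %-absorbʳ : ∀ u i → (u ℕ.+ i % k) % k ≡ (u ℕ.+ i) % k
  %-absorbʳ u i = ≡.trans (%-distribˡ-+ u (i % k) k)
    (≡.trans (≡.cong (λ w → (u % k ℕ.+ w) % k) (m%n%n≡m%n i k)) (≡.sym (%-distribˡ-+ u i k)))

  mod-offset-≢ : ∀ {u} i → 0 ℕ.< u → u ℕ.< k → (u ℕ.+ i) mod k ≢ i mod k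
  mod-offset-≢ {u} i 0<u u<k eq = [u+r]%k≢r 0<u u<k (m%n<n i k)
    (≡.trans (%-absorbʳ u i) (≡.trans (≡.sym (toℕ-mod (u ℕ.+ i))) (≡.trans (≡.cong toℕ eq) (toℕ-mod i))))

next-mod : ∀ {k} i → next {suc k} (i mod suc k) ≡ suc i mod suc k
next-mod {k} i = mod-cong (suc (toℕ (i mod suc k))) (suc i) (≡.trans (≡.cong (λ r → suc r % suc k) (toℕ-mod i)) (%-absorbʳ {suc k} 1 i))

-- From a regular polygon to homothets realising the graph

module RegularPolygon (ℝ : CompleteOrderedField) {k-1 : ℕ} {P : Pred (Plane.Point ℝ) 0ℓ}
  (3≤k : 3 ℕ.≤ suc k-1) (v : Fin (suc k-1) → Plane.Point ℝ)
  (isConvexPosition : Plane.IsConvexPosition ℝ v)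
  (isEquilateral : Plane.IsEquilateral ℝ v) (isEquiangular : Plane.IsEquiangular ℝ v)
  (P≐hull : P ≐ Plane.convexHull ℝ v) where
  open CompleteOrderedField ℝ
  open Plane ℝ
  open OrderedField ℝ
  open CrossProduct ℝ
  open ConvexHull ℝ
  open Solver using (solve; con; _:=_; _:+_; _:*_; :-_; _:-_)

  private
    k m : ℕ
    k = suc k-1
    m = ⌊ k /2⌋

    instance
      m≢0 : NonZero m
      m≢0 = 3≤k⇒⌊k/2⌋≢0 3≤k

  V : ℕ → Point
  V i = v (i mod k)

  edge≡ : ∀ i → edge v (i mod k) ≡ edges V i
  edge≡ i = ≡.cong (λ j → v j -ₚ V i) (next-mod i)

  edge-next≡ : ∀ i → edge v (next (i mod k)) ≡ edges V (suc i)
  edge-next≡ i = ≡.trans (≡.cong (edge v) (next-mod i)) (edge≡ (suc i))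

  regular : RegularSequence k V
  regular = record
    { 3≤k         = 3≤k
    ; periodic    = λ i → ≡.cong v (mod-cong (k ℕ.+ i) i (≡.trans (≡.cong (_% k) (ℕ.+-comm k i)) ([m+n]%n≡m%n i k)))
    ; convex      = convex
    ; equilateral = λ i j → ≡.subst₂ (λ p q → dot p p ≈ dot q q) (edge≡ i) (edge≡ j) (isEquilateral (i mod k) (j mod k))
    ; equiangular = λ i j → trans (reflexive (≡.cong₂ dot (≡.sym (edge≡ i)) (≡.sym (edge-next≡ i))))
        (trans (isEquiangular (i mod k) (j mod k)) (reflexive (≡.cong₂ dot (edge≡ j) (edge-next≡ j))))
    }
    where
    convex : ∀ i u → 2 ℕ.≤ u → u ℕ.< k → 0# < cross (edges V i) (V (u ℕ.+ i) -ₚ V i)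
    convex i (suc u) (ℕ.s≤s 1≤u) u<k = ≡.subst (λ p → 0# < cross p (V (suc u ℕ.+ i) -ₚ V i)) (edge≡ i)
      -- The vertex differs from both ends of the edge because its offsets from them, u + 1 and u,
      -- lie strictly between 0 and `k`.
      (isConvexPosition (i mod k) ((suc u ℕ.+ i) mod k)
        (mod-offset-≢ i (ℕ.s≤s ℕ.z≤n) u<k)
        λ eq → mod-offset-≢ (suc i) 1≤u (ℕ.<-trans (ℕ.n<1+n u) u<k)
          (≡.trans (≡.cong (_mod k) (ℕ.+-suc u i)) (≡.trans eq (next-mod i))))

  hull : IsHull P V
  hull = record
    { V∈P      = λ i → proj₂ P≐hull (vertex∈hull v (i mod k))
    ; P-convex = λ 0≤a 0≤b 0≤c a+b+c≈1 p∈P q∈P r∈P x≈ → proj₂ P≐hull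
        (hull-convex v 0≤a 0≤b 0≤c a+b+c≈1 (proj₁ P≐hull p∈P) (proj₁ P≐hull q∈P) (proj₁ P≐hull r∈P) x≈)
    ; P-bounds = λ {a} {o} {t} lower upper p∈P → hull-cross-bounds v
        (λ i → ≡.subst (λ j → 0# ≤ cross a (v j -ₚ o)) (toℕ-mod-inverse i) (lower (toℕ i)))
        (λ i → ≡.subst (λ j → cross a (v j -ₚ o) ≤ t) (toℕ-mod-inverse i) (upper (toℕ i)))
        (proj₁ P≐hull p∈P)
    }

  open Arrangement ℝ regular hull
    m ⌈ k /2⌉ (≡.trans (ℕ.+-comm ⌈ k /2⌉ m) (ℕ.⌊n/2⌋+⌈n/2⌉≡n k)) (⌈n/2⌉≡⌊n/2⌋⊎ k)
  open DifferenceBody ℝ (IsHull.P-convex hull)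

  module _ (n : ℕ) where

    -- The bound `suc n` dominates every rank and is nonzero even for the empty graph.
    centre : Fin n → Point
    centre i = position (suc n) (labelOf m i)

    copy : Fin n → Pred Point 0ℓ
    copy i q = ∃[ p ] p ∈ P × q ≈ₚ 2# *ₚ p +ₚ centre i

    rank≤ : ∀ i → proj₂ (proj₂ (labelOf m i)) ℕ.≤ suc n
    rank≤ i = ℕ.≤-trans (m/n≤m (toℕ i / 2) m) (ℕ.≤-trans (m/n≤m (toℕ i) 2) (ℕ.<⇒≤ (ℕ.<-trans (Fin.toℕ<n i) (ℕ.n<1+n n))))

    touch⇒meet : ∀ i j → centre i -ₚ centre j ∈ E → copy i ≬ copy j
    -- The two centres differ by 2p - 2q, so 2q shifted by `centre i` and 2p shifted by `centre j`
    -- are one common point.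
    touch⇒meet i j (p , q , p∈P , q∈P , eq₁ , eq₂) = _ , (q , q∈P , refl , refl) , (p , p∈P , coordinate eq₁ , coordinate eq₂)
      where
      coordinate : ∀ {u w x y} → u - w ≈ x - y → y + u ≈ x + w
      coordinate {u} {w} {x} {y} eq = begin-equality
        y + u             ≈⟨ solve 3 (λ u w y → y :+ u := y :+ w :+ (u :- w)) refl u w y ⟩
        y + w + (u - w)   ≈⟨ +-congˡ eq ⟩
        y + w + (x - y)   ≈⟨ solve 3 (λ w x y → y :+ w :+ (x :- y) := x :+ w) refl w x y ⟩
        x + w             ∎
        where open ≤-Reasoning

    meet⇒touch : ∀ i j → copy i ≬ copy j → centre i -ₚ centre j ∈ E
    meet⇒touch i j (_ , (p , p∈P , z₁≈ , z₂≈) , (q , q∈P , z₁≈′ , z₂≈′)) =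
      q , p , q∈P , p∈P , coordinate z₁≈ z₁≈′ , coordinate z₂≈ z₂≈′
      where
      coordinate : ∀ {z u w x y} → z ≈ x + u → z ≈ y + w → u - w ≈ y - x
      coordinate {z} {u} {w} {x} {y} eq eq′ = begin-equality
        u - w             ≈⟨ solve 3 (λ u w x → u :- w := (x :+ u) :- (x :+ w)) refl u w x ⟩
        (x + u) - (x + w) ≈⟨ +-congʳ (trans (sym eq) eq′) ⟩
        (y + w) - (x + w) ≈⟨ solve 3 (λ w x y → (y :+ w) :- (x :+ w) := y :- x) refl w x y ⟩
        y - x             ∎
        where open ≤-Reasoning

    cliqueGraph∈Hom : cliqueGraph m n ∈Hom P
    cliqueGraph∈Hom = copy , (λ i → 2# , centre i , 0<2 , id , id) , λ i j → mk⇔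
      (λ { (i≢j , ¬c) → i≢j , touch⇒meet i j (¬conflict⇒touch (suc n) (labelOf m i) (labelOf m j) (rank≤ i) (rank≤ j) ¬c) })
      (λ { (i≢j , meet) → i≢j , λ c → conflict⇒apart (suc n) (labelOf m i) (labelOf m j) c (meet⇒touch i j meet) })

-- The clique bounds

-- The base uses `suc m` so that it is visibly nonzero for every `k`, including the small ones for
-- which a positive constant must still be named.
n^m≤K*#maximalCliques : ∀ m .{{_ : NonZero m}} n → m ℕ.* 2 ℕ.≤ n →
  n ℕ.^ m ℕ.≤ (4 ℕ.* suc m) ℕ.^ m ℕ.* #maximalCliques (cliqueGraph m n)
n^m≤K*#maximalCliques m n 2m≤n = begin
  n ℕ.^ m                                    ≤⟨ ℕ.^-monoˡ-≤ m (n≤4m[n/2/m] m 2m≤n) ⟩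
  (4 ℕ.* m ℕ.* r) ℕ.^ m                      ≤⟨ ℕ.^-monoˡ-≤ m (ℕ.*-monoˡ-≤ r (ℕ.*-monoʳ-≤ 4 (ℕ.n≤1+n m))) ⟩
  (4 ℕ.* suc m ℕ.* r) ℕ.^ m                  ≡⟨ ^-distrib-*ℕ (4 ℕ.* suc m) r m ⟩
  (4 ℕ.* suc m) ℕ.^ m ℕ.* r ℕ.^ m            ≤⟨ ℕ.*-monoʳ-≤ ((4 ℕ.* suc m) ℕ.^ m) (#maximalCliques-≥ m n) ⟩
  (4 ℕ.* suc m) ℕ.^ m ℕ.* #maximalCliques (cliqueGraph m n) ∎
  where
  open ℕ.≤-Reasoning
  r = rankBound m n

theorem6 : (ℝ : CompleteOrderedField) →
    let open CompleteOrderedField ℝ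
        open RealPower ℝ
        open Plane ℝ
    in
    Σ[ G ∈ (∀ k (P : Pred Point 0ℓ) → IsRegularPolygon k P → ∀ n → Graph n) ]
      (∀ k P (reg : IsRegularPolygon k P) n → G k P reg n ∈Hom P) ×
      (∀ ε → 0# < ε →
        ∃[ c ] (0# < c) × (∀ k → ∃[ n₀ ]
          (∀ P (reg : IsRegularPolygon k P) n .{{_ : NonZero n}} → n₀ ℕ.≤ n →
            c * n ^ʳ (fromℕ ⌊ k /2⌋ * (1# - ε)) ≤ fromℕ (#maximalCliques (G k P reg n))))) ×
      (∀ k → ∃[ c ] (0# < c) × (∃[ n₀ ]
        (∀ P (reg : IsRegularPolygon k P) n → n₀ ℕ.≤ n →
          c * fromℕ n ^ ⌊ k /2⌋ ≤ fromℕ (#maximalCliques (G k P reg n)))))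
theorem6 ℝ = G , G∈Hom , polynomial-ε , polynomial
  where
  open CompleteOrderedField ℝ
  open RealPower ℝ
  open Plane ℝ
  open OrderedField ℝ
  open Growth ℝ

  G : ∀ k (P : Pred Point 0ℓ) → IsRegularPolygon k P → ∀ n → Graph n
  G k P reg n = cliqueGraph ⌊ k /2⌋ {{3≤k⇒⌊k/2⌋≢0 (proj₁ reg)}} n

  G∈Hom : ∀ k P (reg : IsRegularPolygon k P) n → G k P reg n ∈Hom P
  G∈Hom (suc k-1) P (3≤k , v , conv , equil , equi , P≐hull) n =
    RegularPolygon.cliqueGraph∈Hom ℝ 3≤k v conv equil equi P≐hull n

  K : ℕ → ℕ
  K k = (4 ℕ.* suc ⌊ k /2⌋) ℕ.^ ⌊ k /2⌋

  instance
    K≢0 : ∀ {k} → NonZero (K k)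
    K≢0 {k} = ℕ.m^n≢0 (4 ℕ.* suc ⌊ k /2⌋) ⌊ k /2⌋

  polynomial-ε : ∀ ε → 0# < ε →
    ∃[ c ] (0# < c) × (∀ k → ∃[ n₀ ]
      (∀ P (reg : IsRegularPolygon k P) n .{{_ : NonZero n}} → n₀ ℕ.≤ n →
        c * n ^ʳ (fromℕ ⌊ k /2⌋ * (1# - ε)) ≤ fromℕ (#maximalCliques (G k P reg n))))
  polynomial-ε ε 0<ε with archimedean-inverse ε 0<ε
  -- The constant is 1 for all `k`, since the threshold absorbs `K k`. Its first summand guarantees
  -- at least one complete rank, its second makes `n` at least the power of `K k` that the loss in
  -- the exponent outweighs.
  ... | e , 1≤eε = 1# , 0<1 , λ k → ⌊ k /2⌋ ℕ.* 2 ℕ.+ K k ℕ.^ suc e , λ P reg n n₀≤n →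
    ≤-respˡ-≈ (sym (*-identityˡ _))
      (realPower-≤ (K k) (suc e) n ⌊ k /2⌋ _ ε {{K≢0 {k}}} {{_}} {{_}} {{3≤k⇒⌊k/2⌋≢0 (proj₁ reg)}} 1≤eε (ℕ.m+n≤o⇒n≤o _ n₀≤n)
        (n^m≤K*#maximalCliques ⌊ k /2⌋ {{3≤k⇒⌊k/2⌋≢0 (proj₁ reg)}} n (ℕ.m+n≤o⇒m≤o _ n₀≤n)))

  polynomial : ∀ k → ∃[ c ] (0# < c) × (∃[ n₀ ]
    (∀ P (reg : IsRegularPolygon k P) n → n₀ ℕ.≤ n →
      c * fromℕ n ^ ⌊ k /2⌋ ≤ fromℕ (#maximalCliques (G k P reg n))))
  polynomial k with pos-inverse (fromℕ-pos (K k) {{K≢0 {k}}})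
  -- Here `k` is fixed before the constant, so `c` can be the inverse of `K k` and the threshold
  -- only has to provide one complete rank.
  ... | c , 0<c , Kc≈1 = c , 0<c , ⌊ k /2⌋ ℕ.* 2 , λ P reg n n₀≤n →
    let C = #maximalCliques (G k P reg n) in begin
    c * fromℕ n ^ ⌊ k /2⌋         ≈⟨ *-congˡ (fromℕ-^ n ⌊ k /2⌋) ⟨
    c * fromℕ (n ℕ.^ ⌊ k /2⌋)     ≤⟨ *-monoˡ-≤ (proj₁ 0<c) (fromℕ-mono-≤
                                       (n^m≤K*#maximalCliques ⌊ k /2⌋ {{3≤k⇒⌊k/2⌋≢0 (proj₁ reg)}} n n₀≤n)) ⟩
    c * fromℕ (K k ℕ.* C)         ≈⟨ *-congˡ (fromℕ-* (K k) C) ⟩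
    c * (fromℕ (K k) * fromℕ C)   ≈⟨ *-assoc _ _ _ ⟨
    c * fromℕ (K k) * fromℕ C     ≈⟨ *-congʳ (trans (*-comm _ _) Kc≈1) ⟩
    1# * fromℕ C                  ≈⟨ *-identityˡ _ ⟩
    fromℕ C                       ∎
    where open ≤-Reasoning
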